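{- Let $1\le k<n$ be integers. For every 1-terminal chord diagram $T$ of size $n$ with connectivity $\kappa(T)=n-k$, the connectivity $j=\kappa(\psi(T))$ satisfies $n-2k\le j<n-k$. Furthermore, for all integers $n,k,j$ with $1\le k<n$, $j\ge0$ and $n-2k\le j<n-k$, there exists a 1-terminal chord diagram $T$ of size $n$ with $\kappa(T)=n-k$ and $\kappa(\psi(T))=j$.
   Context: A chord diagram of size $n$ is a perfect matching of $\{1,\dots,2n\}$; chords are ordered pairs $(a,b)$ with $a<b$, $a$ the source and $b$ the sink. For chords $c_1=(a_1,b_1)$, $c_2=(a_2,b_2)$ with $a_1<a_2$, they cross if $a_2<b_1<b_2$, and then $c_2$ is a right neighbor of $c_1$. The intersection graph has chords as vertices and crossings as edges. The connectivity $\kappa(C)$ of a diagram is the vertex connectivity of its (undirected) intersection graph: the minimum number of vertices whose removal disconnects it, with the usual convention that a complete graph on $m$ vertices has connectivity $m-1$. A chord is terminal if it has no right neighbors. A diagram is 1-terminal if no chord other than the last one, in the order of sources, is terminal. The map $\psi$ from 1-terminal diagrams of size $n$ to diagrams of size $n-1$ ($n\ge 2$): let $T$ be 1-terminal with chords $c_1<\dots<c_n$ ordered by source. The source-sink group of a chord $c$ consists of the source of $c$ together with the maximal run of consecutive sinks immediately following it (excluding the sink of $c$ itself). Then $\psi(T)$ is obtained from $T$ by (1) moving each source to the end of its source-sink group (all other endpoints keeping their relative order and every source staying paired with its sink), and (2) deleting the terminal chord $c_n$; endpoints are then relabelled order-preservingly. -}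

module Defs where

open import Data.Bool using (T)
open import Data.Unit using (tt)
open import Data.Empty using (⊥)
open import Data.Fin using (Fin; zero; suc; toℕ; fromℕ<; inject₁; punchOut)
import Data.Fin as Fin
open import Data.Fin.Properties as Finₚ using (any?; all?)
open import Data.Fin.Subset using (Subset; _∈_; _∉_; _⊆_; _∪_; ∁; ⁅_⁆; ∣_∣)
open import Data.Fin.Subset.Properties
  using (_∈?_; anySubset?; x∈⁅x⁆; x∈⁅y⁆⇒x≡y; x∈p∪q⁺; x∈p∪q⁻; x∈p⇒x∉∁p; x∉∁p⇒x∈p;
         p⊆q⇒∣p∣≤∣q∣; p⊂q⇒∣p∣<∣q∣; ∣p∣≤n)
open import Data.Nat using (ℕ; zero; suc; _+_; _*_; _∸_; _≤_; _<_; z≤n; s≤s)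
open import Data.Nat.Properties as ℕₚ using (_<?_; ≤-refl; <-irrefl; <-≤-trans)
open import Data.Product using (∃; ∃-syntax; ∃₂; _×_; _,_; proj₁; proj₂)
open import Data.Sum using (_⊎_; inj₁; inj₂; [_,_]′)
import Data.Sum as Sum
open import Data.Sum.Properties using (inj₁-injective; inj₂-injective)
open import Data.Vec using (tabulate)
open import Data.Vec.Properties using (lookup∘tabulate; lookup⇒[]=; []=⇒lookup)
open import Function using (_∘_)
open import Function.Definitions using (Injective; Bijective)
open import Level using (0ℓ)
open import Relation.Binary.Core using (Rel)
open import Relation.Binary.Definitions
  using (Decidable; Symmetric; Irreflexive; tri<; tri≈; tri>)
open import Relation.Binary.Construct.Closure.ReflexiveTransitive using (Star; ε; _◅_; _◅◅_)
open import Relation.Binary.PropositionalEquality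
open import Relation.Nullary using (¬_; Dec; yes; no; does; contradiction)
open import Relation.Nullary.Decidable using (map′; dec-true; _×-dec_; _⊎-dec_; _→-dec_; ¬?)
import Relation.Unary as U

record Graph (n : ℕ) : Set₁ where
  field
    Adj         : Rel (Fin n) 0ℓ
    adj?        : Decidable Adj
    symmetric   : Symmetric Adj
    irreflexive : Irreflexive _≡_ Adj

module _ {n : ℕ} (G : Graph n) where
  open Graph G

  Complete : Set
  Complete = ∀ u v → u ≢ v → Adj u v

  AdjOutside : Subset n → Rel (Fin n) 0ℓ
  AdjOutside S u v = u ∉ S × v ∉ S × Adj u v

  -- Removing S leaves two vertices that no walk avoiding S joins.
  Disconnects : Subset n → Set
  Disconnects S = ∃₂ λ u v → u ∉ S × v ∉ S × ¬ Star (AdjOutside S) u v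

  record IsConnectivity (κ : ℕ) : Set where
    field
      complete    : Complete → κ ≡ n ∸ 1
      attained    : ¬ Complete → ∃[ S ] (∣ S ∣ ≡ κ × Disconnects S)
      lower-bound : ¬ Complete → ∀ S → Disconnects S → κ ≤ ∣ S ∣

-- Reachability in a finite graph is decidable: eliminate vertex zero by
-- replacing each path u → zero → v with a direct step.
private
  Bypass : ∀ {n} → Rel (Fin (suc n)) 0ℓ → Rel (Fin n) 0ℓ
  Bypass R u v = R (suc u) (suc v) ⊎ (R (suc u) zero × R zero (suc v))

  bypass⇒star : ∀ {n} {R : Rel (Fin (suc n)) 0ℓ} {u v} →
                Star (Bypass R) u v → Star R (suc u) (suc v)
  bypass⇒star ε = ε
  bypass⇒star (inj₁ r ◅ rs) = r ◅ bypass⇒star rs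
  bypass⇒star (inj₂ (r , r′) ◅ rs) = r ◅ r′ ◅ bypass⇒star rs

  mutual
    star⇒bypass : ∀ {n} {R : Rel (Fin (suc n)) 0ℓ} {u v} →
                  Star R (suc u) (suc v) → Star (Bypass R) u v
    star⇒bypass ε = ε
    star⇒bypass (_◅_ {j = suc w} r rs) = inj₁ r ◅ star⇒bypass rs
    star⇒bypass (_◅_ {j = zero} r rs) with leave-zero rs
    ... | w , r′ , rs′ = inj₂ (r , r′) ◅ rs′

    leave-zero : ∀ {n} {R : Rel (Fin (suc n)) 0ℓ} {v} → Star R zero (suc v) →
                 ∃ λ w → R zero (suc w) × Star (Bypass R) w v
    leave-zero (_◅_ {j = zero} r rs) = leave-zero rs
    leave-zero (_◅_ {j = suc w} r rs) = w , r , star⇒bypass rs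

  enter-zero : ∀ {n} {R : Rel (Fin (suc n)) 0ℓ} {u} → Star R (suc u) zero →
               ∃ λ w → Star (Bypass R) u w × R (suc w) zero
  enter-zero {u = u} (_◅_ {j = zero} r rs) = u , ε , r
  enter-zero (_◅_ {j = suc _} r rs) with enter-zero rs
  ... | w , rs′ , r′ = w , inj₁ r ◅ rs′ , r′

star? : ∀ {n} {R : Rel (Fin n) 0ℓ} → Decidable R → Decidable (Star R)
star? {suc n} {R} R? = go
  where
  step? : Decidable (Star (Bypass R))
  step? = star? λ u v → R? (suc u) (suc v) ⊎-dec (R? (suc u) zero ×-dec R? zero (suc v))

  go : Decidable (Star R)
  go zero zero = yes ε
  go zero (suc v) = map′ (λ { (w , r , rs) → r ◅ bypass⇒star rs }) leave-zero
    (any? λ w → R? zero (suc w) ×-dec step? w v)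
  go (suc u) zero = map′ (λ { (w , rs , r) → bypass⇒star rs ◅◅ (r ◅ ε) }) enter-zero
    (any? λ w → step? u w ×-dec R? (suc w) zero)
  go (suc u) (suc v) = map′ bypass⇒star star⇒bypass (step? u v)

least : {P : ℕ → Set} → U.Decidable P → ∀ {b} → P b → ∃ λ m → P m × (∀ {x} → P x → m ≤ x)
least P? {zero} p = zero , p , λ _ → z≤n
least {P} P? {suc b} p with P? zero
... | yes p₀ = zero , p₀ , λ _ → z≤n
... | no ¬p₀ with least {P ∘ suc} (P? ∘ suc) {b} p
...   | m , q , min = suc m , q , λ { {zero} r → contradiction r ¬p₀ ; {suc x} r → s≤s (min r) }

module _ {n : ℕ} (G : Graph n) where
  open Graph G

  complete? : Dec (Complete G)
  complete? = all? λ u → all? λ v → ¬? (u Finₚ.≟ v) →-dec adj? u v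

  disconnects? : U.Decidable (Disconnects G)
  disconnects? S = any? λ u → any? λ v →
    ¬? (u ∈? S) ×-dec ¬? (v ∈? S) ×-dec
    ¬? (star? (λ x y → ¬? (x ∈? S) ×-dec ¬? (y ∈? S) ×-dec adj? x y) u v)

  private
    nonadjacent : ¬ Complete G → ∃₂ λ u v → u ≢ v × ¬ Adj u v
    nonadjacent ¬c with any? (λ u → any? λ v → ¬? (u Finₚ.≟ v) ×-dec ¬? (adj? u v))
    ... | yes p = p
    ... | no ¬p = contradiction
      (λ u v u≢v → dne u v (λ ¬a → ¬p (u , v , u≢v , ¬a))) ¬c
      where
      dne : ∀ u v → ¬ ¬ Adj u v → Adj u v
      dne u v ¬¬a with adj? u v
      ... | yes a = a
      ... | no ¬a = contradiction ¬a ¬¬a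

    separator : ¬ Complete G → ∃ (Disconnects G)
    separator ¬c with nonadjacent ¬c
    ... | u , v , u≢v , ¬a = S , u , v ,
        x∈p⇒x∉∁p (x∈p∪q⁺ (inj₁ (x∈⁅x⁆ u))) ,
        x∈p⇒x∉∁p (x∈p∪q⁺ (inj₂ (x∈⁅x⁆ v))) , stuck
      where
      S : Subset n
      S = ∁ (⁅ u ⁆ ∪ ⁅ v ⁆)

      step : ∀ {w} → AdjOutside G S u w → ⊥
      step {w} (_ , w∉S , a) with x∈p∪q⁻ ⁅ u ⁆ ⁅ v ⁆ (x∉∁p⇒x∈p w∉S)
      ... | inj₁ w∈u = irreflexive (sym (x∈⁅y⁆⇒x≡y u w∈u)) a
      ... | inj₂ w∈v with refl ← x∈⁅y⁆⇒x≡y v w∈v = ¬a a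

      stuck : ¬ Star (AdjOutside G S) u v
      stuck ε = u≢v refl
      stuck (r ◅ _) = step r

  connectivity : ∃ (IsConnectivity G)
  connectivity with complete?
  ... | yes c = n ∸ 1 , record
    { complete = λ _ → refl
    ; attained = λ ¬c → contradiction c ¬c
    ; lower-bound = λ ¬c → contradiction c ¬c }
  ... | no ¬c with separator ¬c
  ... | S₀ , d₀ with least (λ κ → anySubset? λ S → ∣ S ∣ ℕₚ.≟ κ ×-dec disconnects? S)
                           (S₀ , refl , d₀)
  ... | κ , att , min = κ , record
    { complete = λ c → contradiction c ¬c
    ; attained = λ _ → att
    ; lower-bound = λ _ S d → min (S , refl , d) }

  κ-graph : ℕ
  κ-graph = proj₁ connectivity

-- A perfect matching of the 2n points, with its chords listed in increasing
-- order of source; a matching has exactly one such listing.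
record ChordDiagram (n : ℕ) : Set where
  field
    source      : Fin n → Fin (2 * n)
    sink        : Fin n → Fin (2 * n)
    source<sink : ∀ i → source i Fin.< sink i
    source-mono : ∀ {i j} → i Fin.< j → source i Fin.< source j
    matching    : Bijective _≡_ _≡_ [ source , sink ]′

module _ {n : ℕ} (C : ChordDiagram n) where
  open ChordDiagram C

  RightNeighbour : Rel (Fin n) 0ℓ
  RightNeighbour c d = source c Fin.< source d × source d Fin.< sink c × sink c Fin.< sink d

  Cross : Rel (Fin n) 0ℓ
  Cross c d = RightNeighbour c d ⊎ RightNeighbour d c

  rightNeighbour? : Decidable RightNeighbour
  rightNeighbour? c d =
    source c Finₚ.<? source d ×-dec source d Finₚ.<? sink c ×-dec sink c Finₚ.<? sink d

  intersectionGraph : Graph n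
  intersectionGraph = record
    { Adj = Cross
    ; adj? = λ c d → rightNeighbour? c d ⊎-dec rightNeighbour? d c
    ; symmetric = Sum.swap
    ; irreflexive = λ { refl (inj₁ (lt , _)) → <-irrefl refl lt
                      ; refl (inj₂ (lt , _)) → <-irrefl refl lt } }

  κ : ℕ
  κ = κ-graph intersectionGraph

  Terminal : Fin n → Set
  Terminal c = ∀ d → ¬ RightNeighbour c d

  OneTerminal : Set
  OneTerminal = ∀ c → suc (toℕ c) ≢ n → ¬ Terminal c

-- Chords listed by source whose distinct endpoints are arbitrary naturals.
record Arrangement (n : ℕ) : Set where
  field
    source      : Fin n → ℕ
    sink        : Fin n → ℕ
    source<sink : ∀ i → source i < sink i
    source-mono : ∀ {i j} → i Fin.< j → source i < source j
    distinct    : Injective _≡_ _≡_ [ source , sink ]′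

private
  injective⇒surjective : ∀ {n} {f : Fin n → Fin n} →
    Injective _≡_ _≡_ f → ∀ y → ∃ λ x → f x ≡ y
  injective⇒surjective {suc n} {f} inj y with any? (λ x → f x Finₚ.≟ y)
  ... | yes p = p
  ... | no ¬p = contradiction (Finₚ.injective⇒≤ {f = g} g-inj) (ℕₚ.<-irrefl refl)
    where
    y≢f : ∀ x → y ≢ f x
    y≢f x y≡fx = ¬p (x , sym y≡fx)
    g : Fin (suc n) → Fin n
    g x = punchOut (y≢f x)
    g-inj : Injective _≡_ _≡_ g
    g-inj {a} {b} eq = inj (Finₚ.punchOut-injective (y≢f a) (y≢f b) eq)

module _ {n : ℕ} where

  below : (Fin n → ℕ) → ℕ → Subset n
  below f x = tabulate λ i → does (f i <? x)

  private
    ∈-below⁺ : ∀ f x {i} → f i < x → i ∈ below f x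
    ∈-below⁺ f x {i} lt = lookup⇒[]= i _
      (trans (lookup∘tabulate _ i) (dec-true (f i <? x) lt))

    ∈-below⁻ : ∀ f x {i} → i ∈ below f x → f i < x
    ∈-below⁻ f x {i} i∈ = ℕₚ.<ᵇ⇒< (f i) x (subst T (sym (trans
      (sym (lookup∘tabulate (λ i → does (f i <? x)) i)) ([]=⇒lookup i∈))) tt)

    below-mono : ∀ f {x y} → x ≤ y → below f x ⊆ below f y
    below-mono f {x} {y} x≤y i∈ = ∈-below⁺ f y (<-≤-trans (∈-below⁻ f x i∈) x≤y)

    below-strict : ∀ f {y} i → f i < y → ∣ below f (f i) ∣ < ∣ below f y ∣
    below-strict f {y} i lt = p⊂q⇒∣p∣<∣q∣
      (below-mono f (ℕₚ.<⇒≤ lt) , i , ∈-below⁺ f y lt , λ i∈ → <-irrefl refl (∈-below⁻ f (f i) i∈))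

  module Relabel (A : Arrangement n) where
    open Arrangement A

    endpoint : Fin n ⊎ Fin n → ℕ
    endpoint = [ source , sink ]′

    -- The number of endpoints less than x.
    rank : ℕ → ℕ
    rank x = ∣ below source x ∣ + ∣ below sink x ∣

    rank-≤ : ∀ x → rank x ≤ 2 * n
    rank-≤ x rewrite ℕₚ.+-identityʳ n =
      ℕₚ.+-mono-≤ (∣p∣≤n (below source x)) (∣p∣≤n (below sink x))

    rank-mono : ∀ e {y} → endpoint e < y → rank (endpoint e) < rank y
    rank-mono (inj₁ i) lt = ℕₚ.+-mono-<-≤ (below-strict source i lt)
      (p⊆q⇒∣p∣≤∣q∣ (below-mono sink (ℕₚ.<⇒≤ lt)))
    rank-mono (inj₂ i) lt = ℕₚ.+-mono-≤-<
      (p⊆q⇒∣p∣≤∣q∣ (below-mono source (ℕₚ.<⇒≤ lt))) (below-strict sink i lt)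

    rank-< : ∀ e → rank (endpoint e) < 2 * n
    rank-< e = <-≤-trans (rank-mono e (ℕₚ.n<1+n _)) (rank-≤ (suc (endpoint e)))

    label : Fin n ⊎ Fin n → Fin (2 * n)
    label e = fromℕ< (rank-< e)

    label-mono : ∀ e f → endpoint e < endpoint f → label e Fin.< label f
    label-mono e f lt = subst₂ _<_
      (sym (Finₚ.toℕ-fromℕ< (rank-< e)))
      (sym (Finₚ.toℕ-fromℕ< (rank-< f)))
      (rank-mono e lt)

    label-injective : Injective _≡_ _≡_ label
    label-injective {e} {f} eq with ℕₚ.<-cmp (endpoint e) (endpoint f)
    ... | tri< lt _ _ = contradiction (label-mono e f lt) (<-irrefl (cong toℕ eq))
    ... | tri≈ _ e≡f _ = distinct e≡f
    ... | tri> _ _ gt = contradiction (label-mono f e gt)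
          (<-irrefl (cong toℕ (sym eq)))

    private
      2n≡n+n : 2 * n ≡ n + n
      2n≡n+n = cong (n +_) (ℕₚ.+-identityʳ n)

      split : Fin (2 * n) → Fin n ⊎ Fin n
      split = Fin.splitAt n ∘ Fin.cast 2n≡n+n

      split-injective : Injective _≡_ _≡_ (label ∘ split)
      split-injective {x} {y} eq = Finₚ.toℕ-injective (begin
        toℕ x                        ≡⟨ Finₚ.toℕ-cast 2n≡n+n x ⟨
        toℕ (Fin.cast 2n≡n+n x)      ≡⟨ cong toℕ (Finₚ.join-splitAt n n _) ⟨
        toℕ (Fin.join n n (split x)) ≡⟨ cong (toℕ ∘ Fin.join n n)
                                             (label-injective {split x} {split y} eq) ⟩
        toℕ (Fin.join n n (split y)) ≡⟨ cong toℕ (Finₚ.join-splitAt n n _) ⟩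
        toℕ (Fin.cast 2n≡n+n y)      ≡⟨ Finₚ.toℕ-cast 2n≡n+n y ⟩
        toℕ y                        ∎)
        where open ≡-Reasoning

    label-surjective : ∀ y → ∃ λ e → label e ≡ y
    label-surjective y
      with injective⇒surjective {f = label ∘ split} (λ {x} {y} → split-injective {x} {y}) y
    ... | x , eq = split x , eq

    relabel : ChordDiagram n
    relabel = record
      { source = label ∘ inj₁
      ; sink = label ∘ inj₂
      ; source<sink = λ i → label-mono (inj₁ i) (inj₂ i) (source<sink i)
      ; source-mono = λ {i} {j} i<j → label-mono (inj₁ i) (inj₁ j) (source-mono i<j)
      ; matching = (λ {e} {f} eq → label-injective {e} {f}
                     (trans (sym (split-label e)) (trans eq (split-label f))))
                 , λ y → let e , eq = label-surjective y in
                     e , λ { refl → trans (split-label e) eq } }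
      where
      split-label : ∀ e → [ label ∘ inj₁ , label ∘ inj₂ ]′ e ≡ label e
      split-label (inj₁ _) = refl
      split-label (inj₂ _) = refl

-- Replaces the endpoints by 0, …, 2n - 1 in the same order.
open Relabel public using (relabel)

greatest : ∀ {n} {P : Fin n → Set} → U.Decidable P → ∃ P →
           ∃ λ m → P m × (∀ x → P x → x Fin.≤ m)
greatest {suc n} {P} P? p with any? (P? ∘ suc)
... | yes q with m , pm , max ← greatest {P = P ∘ suc} (P? ∘ suc) q =
  suc m , pm , λ { zero _ → z≤n ; (suc x) px → s≤s (max x px) }
greatest P? (zero , p₀) | no ¬q =
  zero , p₀ , λ { zero _ → z≤n ; (suc x) px → contradiction (x , px) ¬q }
greatest P? (suc x , px) | no ¬q = contradiction (x , px) ¬q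

module _ {n : ℕ} (C : ChordDiagram n) where
  open ChordDiagram C

  IsSink : Fin (2 * n) → Set
  IsSink p = ∃[ d ] sink d ≡ p

  -- The run stops before the sink of c, so its source never passes it; in a
  -- 1-terminal diagram this concerns only the last chord, which ψ deletes.
  InGroup : Fin n → Fin (2 * n) → Set
  InGroup c p = source c Fin.≤ p × p Fin.< sink c ×
    (∀ q → source c Fin.< q → q Fin.≤ p → IsSink q)

  inGroup? : ∀ c → U.Decidable (InGroup c)
  inGroup? c p = source c Finₚ.≤? p ×-dec p Finₚ.<? sink c ×-dec
    all? λ q → source c Finₚ.<? q →-dec (q Finₚ.≤? p →-dec any? λ d → sink d Finₚ.≟ q)

  source∈group : ∀ c → InGroup c (source c)
  source∈group c = ≤-refl , source<sink c ,
    λ q s<q q≤s → contradiction (<-≤-trans s<q q≤s) (<-irrefl refl)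

  lastOfGroup : ∀ c → ∃ λ p → InGroup c p × (∀ q → InGroup c q → q Fin.≤ p)
  lastOfGroup c = greatest (inGroup? c) (source c , source∈group c)

  groupEnd : Fin n → Fin (2 * n)
  groupEnd c = proj₁ (lastOfGroup c)

  groupEnd<source : ∀ {c d} → c Fin.< d → groupEnd c Fin.< source d
  groupEnd<source {c} {d} c<d with _ , (_ , _ , sinks) , _ ← lastOfGroup c =
    ℕₚ.≰⇒> λ s≤e → let e , eq = sinks (source d) (source-mono c<d) s≤e in
      case-absurd (proj₁ matching {inj₂ e} {inj₁ d} eq)
    where
    case-absurd : ∀ {e d} → inj₂ e ≡ inj₁ d → ⊥
    case-absurd ()

  groupEnd-mono : ∀ {c d} → c Fin.< d → groupEnd c Fin.< groupEnd d
  groupEnd-mono {c} {d} c<d with _ , (s≤e , _) , _ ← lastOfGroup d =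
    <-≤-trans (groupEnd<source c<d) s≤e

  groupEnd-injective : Injective _≡_ _≡_ groupEnd
  groupEnd-injective {c} {d} eq with Finₚ.<-cmp c d
  ... | tri< lt _ _ = contradiction (groupEnd-mono lt) (<-irrefl (cong toℕ eq))
  ... | tri≈ _ c≡d _ = c≡d
  ... | tri> _ _ gt = contradiction (groupEnd-mono gt) (<-irrefl (cong toℕ (sym eq)))

  moved-distinct : Injective _≡_ _≡_
    [ (λ c → suc (2 * toℕ (groupEnd c))) , (λ c → 2 * toℕ (sink c)) ]′
  moved-distinct {inj₁ c} {inj₁ d} eq = cong inj₁ (groupEnd-injective
    (Finₚ.toℕ-injective (ℕₚ.*-cancelˡ-≡ (toℕ (groupEnd c)) (toℕ (groupEnd d)) 2 (ℕₚ.suc-injective eq))))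
  moved-distinct {inj₁ c} {inj₂ d} eq = contradiction (sym eq) (ℕₚ.even≢odd (toℕ (sink d)) (toℕ (groupEnd c)))
  moved-distinct {inj₂ c} {inj₁ d} eq = contradiction eq (ℕₚ.even≢odd (toℕ (sink c)) (toℕ (groupEnd d)))
  moved-distinct {inj₂ c} {inj₂ d} eq = proj₁ matching
    (Finₚ.toℕ-injective (ℕₚ.*-cancelˡ-≡ (toℕ (sink c)) (toℕ (sink d)) 2 eq))

  -- Sinks at position p go to 2p; a source whose group ends at position p goes
  -- to 2p + 1, immediately after whatever is at p.
  moveSources : Arrangement n
  moveSources = record
    { source = λ c → suc (2 * toℕ (groupEnd c))
    ; sink = λ c → 2 * toℕ (sink c)
    ; source<sink = λ c → let _ , (_ , e<s , _) , _ = lastOfGroup c in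
        ℕₚ.<-≤-trans (ℕₚ.≤-reflexive (sym (ℕₚ.*-suc 2 _))) (ℕₚ.*-monoʳ-≤ 2 e<s)
    ; source-mono = λ c<d → s≤s (ℕₚ.*-monoʳ-< 2 (groupEnd-mono c<d))
    ; distinct = moved-distinct }

deleteLast : ∀ {m} → Arrangement (suc m) → Arrangement m
deleteLast A = record
  { source = source ∘ inject₁
  ; sink = sink ∘ inject₁
  ; source<sink = source<sink ∘ inject₁
  ; source-mono = λ {i} {j} i<j → source-mono
      (subst₂ _<_ (sym (Finₚ.toℕ-inject₁ i)) (sym (Finₚ.toℕ-inject₁ j)) i<j)
  ; distinct = λ
      { {inj₁ c} {inj₁ d} eq → cong inj₁ (Finₚ.inject₁-injective (inj₁-injective (distinct eq)))
      ; {inj₁ c} {inj₂ d} eq → contradiction (distinct {inj₁ _} {inj₂ _} eq) λ ()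
      ; {inj₂ c} {inj₁ d} eq → contradiction (distinct {inj₂ _} {inj₁ _} eq) λ ()
      ; {inj₂ c} {inj₂ d} eq → cong inj₂ (Finₚ.inject₁-injective (inj₂-injective (distinct eq))) } }
  where open Arrangement A

-- Chords are listed by source, so the chord deleted is the one with the last
-- source.  Defined for all diagrams, though meant for 1-terminal ones.
ψ : ∀ {m} → ChordDiagram (suc m) → ChordDiagram m
ψ T = relabel (deleteLast (moveSources T))

-- A crossing c < d of T survives in ψ T exactly when some source after that of
-- d precedes the sink of c.  So in a 1-terminal T each chord c other than the
-- last loses just one right neighbour: the last chord whose source precedes the
-- sink of c.
--
-- Connectivity n - k means that two nonempty disjoint sets of chords without
-- crossings between them have at most k chords in total.  A separator of T
-- yields a smaller one of ψ T by deleting either the last chord or a suitable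
-- chord that has lost its neighbours on one side.  Conversely, let A and B be
-- the two sides left by a separator of ψ T, where A contains the first chord,
-- and let b be the first chord of B.  Apart from the lost crossings A and B are
-- uncrossed in T, so the above bound, used twice and with the last chord added
-- to one side, gives |A| + |B| + 1 ≤ 2k.
--
-- For sharpness, put p early chords, s spanning, q ≥ p long, a pivot and a last
-- chord, in this order of sources, with early sinks before the last source and
-- the other sinks in the order spanning, pivot, long, last.  In T exactly the
-- pairs early–last and long–pivot do not cross, so κ T = n - (q + 1); in ψ T
-- exactly the pairs early–pivot and long–pivot do not, so κ (ψ T) = s.
module Submission where

open import Defs
open import Data.Bool using (Bool; true; false; if_then_else_)
import Data.Bool as Bool
open import Data.Fin as Fin using (Fin; zero; suc; toℕ; fromℕ; inject₁; combine; #_; _↑ʳ_)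
open import Data.Fin.Induction using (>-wellFounded)
open import Data.Fin.Properties as Finₚ using (any?; all?; toℕ-inject₁; ≤fromℕ; fromℕ≢inject₁)
open import Data.Fin.Relation.Unary.Top using (view; ‵fromℕ; ‵inject₁)
open import Data.Fin.Subset
  using (Subset; Nonempty; _∈_; _∉_; _⊆_; _∪_; _-_; ∁; ⁅_⁆; ∣_∣; ⊤)
open import Data.Fin.Subset.Properties
open import Data.Nat using (ℕ; zero; suc; _+_; _*_; _∸_; _≤_; _<_; z≤n; s≤s; s≤s⁻¹)
open import Data.Nat.Properties as ℕₚ using (≤-refl; ≤-trans; ≤-reflexive; <-irrefl)
open import Data.Nat.Solver using (module +-*-Solver)
open import Data.Product using (∃-syntax; _×_; _,_; proj₁; proj₂)
open import Data.Sum using (_⊎_; inj₁; inj₂; [_,_]′)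
import Data.Sum as Sum
open import Data.Vec using (Vec; []; _∷_; _++_; lookup; replicate; map; tabulate; here; there)
open import Data.Vec.Properties
  using (lookup∘tabulate; lookup-++ʳ; lookup⇒[]=; []=⇒lookup; tabulate-∘; tabulate∘lookup;
         tabulate-cong)
open import Function using (_∘_)
open import Induction.WellFounded using (Acc; acc)
open import Level using (0ℓ)
open import Relation.Binary.Core using (Rel)
open import Relation.Binary.Construct.Closure.ReflexiveTransitive
  using (Star; ε; _◅_; _◅◅_; gmap; reverse)
open import Relation.Binary.Definitions using (Decidable; tri<; tri≈; tri>)
open import Relation.Binary.PropositionalEquality
open import Relation.Nullary using (¬_; Dec; yes; no; does; contradiction)
open import Relation.Nullary.Decidable
  using (dec-true; decidable-stable; from-yes; ¬?; _×-dec_; _⊎-dec_; _→-dec_)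
import Relation.Unary as U

-- Walks, finite subsets and their sizes.

Star-preserves : ∀ {n} {R : Rel (Fin n) 0ℓ} (Q : Fin n → Set) →
                 (∀ {x y} → R x y → Q x → Q y) → ∀ {x y} → Star R x y → Q x → Q y
Star-preserves Q step ε q = q
Star-preserves Q step (r ◅ rs) q = Star-preserves Q step rs (step r q)

module _ {n : ℕ} {P : Fin n → Set} (P? : U.Decidable P) where

  filter : Subset n
  filter = tabulate (does ∘ P?)

  ∈-filter⁺ : ∀ {i} → P i → i ∈ filter
  ∈-filter⁺ {i} p = lookup⇒[]= i _ (trans (lookup∘tabulate _ i) (dec-true (P? i) p))

  ∈-filter⁻ : ∀ {i} → i ∈ filter → P i
  ∈-filter⁻ {i} i∈ with P? i | trans (sym (lookup∘tabulate (does ∘ P?) i)) ([]=⇒lookup i∈)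
  ... | yes p | _ = p
  ... | no _ | ()

∣p∪q∣≤∣p∣+∣q∣ : ∀ {n} (p q : Subset n) → ∣ p ∪ q ∣ ≤ ∣ p ∣ + ∣ q ∣
∣p∪q∣≤∣p∣+∣q∣ [] [] = z≤n
∣p∪q∣≤∣p∣+∣q∣ (false ∷ p) (false ∷ q) = ∣p∪q∣≤∣p∣+∣q∣ p q
∣p∪q∣≤∣p∣+∣q∣ (false ∷ p) (true ∷ q) =
  ≤-trans (s≤s (∣p∪q∣≤∣p∣+∣q∣ p q)) (≤-reflexive (sym (ℕₚ.+-suc ∣ p ∣ ∣ q ∣)))
∣p∪q∣≤∣p∣+∣q∣ (true ∷ p) (false ∷ q) = s≤s (∣p∪q∣≤∣p∣+∣q∣ p q)
∣p∪q∣≤∣p∣+∣q∣ (true ∷ p) (true ∷ q) =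
  s≤s (≤-trans (∣p∪q∣≤∣p∣+∣q∣ p q) (ℕₚ.+-monoʳ-≤ ∣ p ∣ (ℕₚ.n≤1+n ∣ q ∣)))

∣p∣+∣q∣≤∣p∪q∣ : ∀ {n} (p q : Subset n) → (∀ {x} → x ∈ p → x ∉ q) → ∣ p ∣ + ∣ q ∣ ≤ ∣ p ∪ q ∣
∣p∣+∣q∣≤∣p∪q∣ [] [] d = z≤n
∣p∣+∣q∣≤∣p∪q∣ (false ∷ p) (false ∷ q) d = ∣p∣+∣q∣≤∣p∪q∣ p q λ x y → d (there x) (there y)
∣p∣+∣q∣≤∣p∪q∣ (false ∷ p) (true ∷ q) d =
  ≤-trans (≤-reflexive (ℕₚ.+-suc ∣ p ∣ ∣ q ∣))
    (s≤s (∣p∣+∣q∣≤∣p∪q∣ p q λ x y → d (there x) (there y)))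
∣p∣+∣q∣≤∣p∪q∣ (true ∷ p) (false ∷ q) d = s≤s (∣p∣+∣q∣≤∣p∪q∣ p q λ x y → d (there x) (there y))
∣p∣+∣q∣≤∣p∪q∣ (true ∷ p) (true ∷ q) d = contradiction here (d here)

∣p∣≤1+∣p-x∣ : ∀ {n} (p : Subset n) x → ∣ p ∣ ≤ suc ∣ p - x ∣
∣p∣≤1+∣p-x∣ p x = begin
  ∣ p ∣                   ≤⟨ p⊆q⇒∣p∣≤∣q∣ cover ⟩
  ∣ ⁅ x ⁆ ∪ (p - x) ∣     ≤⟨ ∣p∪q∣≤∣p∣+∣q∣ ⁅ x ⁆ (p - x) ⟩
  ∣ ⁅ x ⁆ ∣ + ∣ p - x ∣   ≡⟨ cong (_+ ∣ p - x ∣) (∣⁅x⁆∣≡1 x) ⟩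
  suc ∣ p - x ∣           ∎
  where
  open ℕₚ.≤-Reasoning
  cover : p ⊆ ⁅ x ⁆ ∪ (p - x)
  cover {y} y∈p with y Finₚ.≟ x
  ... | yes refl = x∈p∪q⁺ (inj₁ (x∈⁅x⁆ x))
  ... | no y≢x = x∈p∪q⁺ (inj₂ (x∈p∧x≢y⇒x∈p-y y∈p y≢x))

-- Removing `x` a second time would shrink `p - x` strictly, yet it changes nothing.
x∉p-x : ∀ {n} (p : Subset n) {x} → x ∉ p - x
x∉p-x p {x} x∈ = <-irrefl (cong ∣_∣ (p─q─q≡p─q p ⁅ x ⁆)) (x∈p⇒∣p-x∣<∣p∣ x∈)

least-element : ∀ {n} (p : Subset n) → Nonempty p → ∃[ a ] (a ∈ p × (∀ {y} → y ∈ p → a Fin.≤ y))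
least-element p (x , x∈p)
  with least (λ t → any? λ i → i ∈? p ×-dec toℕ i ℕₚ.≟ t) (x , x∈p , refl)
... | _ , (a , a∈p , refl) , min = a , a∈p , λ y∈p → min (_ , y∈p , refl)

-- Carries sets of chords of `T` over to `ψ T`, whose chord `i` comes from the chord `inject₁ i`.
restrict : ∀ {n} → Subset (suc n) → Subset n
restrict p = tabulate (lookup p ∘ inject₁)

∈-restrict⁺ : ∀ {n} (p : Subset (suc n)) {i} → inject₁ i ∈ p → i ∈ restrict p
∈-restrict⁺ p {i} i∈ = lookup⇒[]= i _ (trans (lookup∘tabulate _ i) ([]=⇒lookup i∈))

∈-restrict⁻ : ∀ {n} (p : Subset (suc n)) {i} → i ∈ restrict p → inject₁ i ∈ p
∈-restrict⁻ p {i} i∈ =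
  lookup⇒[]= _ p (trans (sym (lookup∘tabulate (lookup p ∘ inject₁) i)) ([]=⇒lookup i∈))

∣restrict∣-∈ : ∀ {n} (p : Subset (suc n)) → fromℕ n ∈ p → ∣ p ∣ ≡ suc ∣ restrict p ∣
∣restrict∣-∈ {zero} (true ∷ []) _ = refl
∣restrict∣-∈ {suc n} (false ∷ p) (there z∈p) = ∣restrict∣-∈ p z∈p
∣restrict∣-∈ {suc n} (true ∷ p) (there z∈p) = cong suc (∣restrict∣-∈ p z∈p)

∣restrict∣-∉ : ∀ {n} (p : Subset (suc n)) → fromℕ n ∉ p → ∣ p ∣ ≡ ∣ restrict p ∣
∣restrict∣-∉ {zero} (false ∷ []) _ = refl
∣restrict∣-∉ {zero} (true ∷ []) z∉p = contradiction here z∉p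
∣restrict∣-∉ {suc n} (false ∷ p) z∉p = ∣restrict∣-∉ p (z∉p ∘ there)
∣restrict∣-∉ {suc n} (true ∷ p) z∉p = cong suc (∣restrict∣-∉ p (z∉p ∘ there))

∣S∣+∣∁S∣≡n : ∀ {n} (S : Subset n) → ∣ S ∣ + ∣ ∁ S ∣ ≡ n
∣S∣+∣∁S∣≡n S = trans (cong (∣ S ∣ +_) (∣∁p∣≡n∸∣p∣ S)) (ℕₚ.m+[n∸m]≡n (∣p∣≤n S))

-- Separators and vertex connectivity.

module _ {n : ℕ} (G : Graph n) where
  open Graph G

  adjOutside? : ∀ S → Decidable (AdjOutside G S)
  adjOutside? S x y = ¬? (x ∈? S) ×-dec ¬? (y ∈? S) ×-dec adj? x y

  joined? : ∀ S → Decidable (Star (AdjOutside G S))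
  joined? S = star? (adjOutside? S)

  disconnects⇒¬complete : ∀ {S} → Disconnects G S → ¬ Complete G
  disconnects⇒¬complete (u , v , u∉S , v∉S , ¬uv) c with u Finₚ.≟ v
  ... | yes refl = ¬uv ε
  ... | no u≢v = ¬uv ((u∉S , v∉S , c u v u≢v) ◅ ε)

  -- The complement of `p ∪ q` is a separator, as a walk avoiding it cannot pass from `p` to `q`.
  -- Its size `n ∸ ∣ p ∪ q ∣` is therefore at least `n ∸ k`.
  nonadjacent-sets-≤ : ∀ {k} → k ≤ n → (∀ S → Disconnects G S → n ∸ k ≤ ∣ S ∣) →
    (p q : Subset n) → Nonempty p → Nonempty q → (∀ {x} → x ∈ p → x ∉ q) →
    (∀ {x y} → x ∈ p → y ∈ q → ¬ Adj x y) → ∣ p ∣ + ∣ q ∣ ≤ k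
  nonadjacent-sets-≤ {k} k≤n bound p q (u , u∈p) (v , v∈q) disj nonadj =
    ≤-trans (∣p∣+∣q∣≤∣p∪q∣ p q disj) (ℕₚ.∸-cancelʳ-≤ (∣p∣≤n (p ∪ q))
      (≤-trans (bound S d) (≤-reflexive (∣∁p∣≡n∸∣p∣ (p ∪ q)))))
    where
    S : Subset n
    S = ∁ (p ∪ q)

    stay : ∀ {x y} → AdjOutside G S x y → x ∈ p → y ∈ p
    stay (_ , y∉S , a) x∈p with x∈p∪q⁻ p q (x∉∁p⇒x∈p y∉S)
    ... | inj₁ y∈p = y∈p
    ... | inj₂ y∈q = contradiction a (nonadj x∈p y∈q)

    d : Disconnects G S
    d = u , v , x∈p⇒x∉∁p (x∈p∪q⁺ (inj₁ u∈p)) , x∈p⇒x∉∁p (x∈p∪q⁺ (inj₂ v∈q)) ,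
        λ w → disj (Star-preserves (_∈ p) stay w u∈p) v∈q

  -- A vertex outside S and outside C would be a common neighbour of the two
  -- separated vertices.
  ∁separator⊆ : ∀ {S u v} → u ∉ S → v ∉ S → ¬ Star (AdjOutside G S) u v → (C : Subset n) → u ∈ C →
    (∀ {x y} → x ∈ C → x ≢ y → ¬ Adj x y → y ∈ C) → ∁ S ⊆ C
  ∁separator⊆ {S} {u} {v} u∉S v∉S ¬uv C u∈C closed {w} w∈∁S = decidable-stable (w ∈? C) λ w∉C →
    ¬uv ((u∉S , w∉S , adjacent u∈C w∉C) ◅ (w∉S , v∉S , symmetric (adjacent v∈C w∉C)) ◅ ε)
    where
    w∉S : w ∉ S
    w∉S = x∈∁p⇒x∉p w∈∁S

    adjacent : ∀ {x y} → x ∈ C → y ∉ C → Adj x y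
    adjacent {x} {y} x∈C y∉C = decidable-stable (adj? x y) λ ¬a →
      y∉C (closed x∈C (λ { refl → y∉C x∈C }) ¬a)

    v∈C : v ∈ C
    v∈C = closed u∈C (λ { refl → ¬uv ε }) λ a → ¬uv ((u∉S , v∉S , a) ◅ ε)

module _ {n : ℕ} (G : Graph n) {μ : ℕ} (isConnectivity : IsConnectivity G μ) where
  open Graph G
  open IsConnectivity isConnectivity

  κ≤separator : ∀ {S} → Disconnects G S → μ ≤ ∣ S ∣
  κ≤separator {S} d = lower-bound (disconnects⇒¬complete G d) S d

  κ≤n∸1 : μ ≤ n ∸ 1
  κ≤n∸1 = by-cases (complete? G)
    where
    by-cases : Dec (Complete G) → μ ≤ n ∸ 1
    by-cases (yes c) = ≤-reflexive (complete c)
    by-cases (no ¬c) with S , ∣S∣≡κ , u , _ , u∉S , _ ← attained ¬c = ℕₚ.<⇒≤pred (begin-strict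
      μ         ≡⟨ ∣S∣≡κ ⟨
      ∣ S ∣     <⟨ p⊂q⇒∣p∣<∣q∣ ((λ _ → ∈⊤) , u , ∈⊤ , u∉S) ⟩
      ∣ ⊤ {n} ∣ ≡⟨ ∣⊤∣≡n n ⟩
      n         ∎)
      where open ℕₚ.≤-Reasoning

  -- If `C` has a vertex besides `c`, deleting everything outside `C` isolates `c` from it;
  -- otherwise `κ≤n∸1` serves. Conversely, a least separator leaves at most `∣ C ∣` vertices, and a
  -- complete graph has connectivity `n ∸ 1` while `∣ C ∣` is at least 1.
  κ≡n∸∣C∣ : (C : Subset n) (c : Fin n) → c ∈ C → (∀ {v} → v ∈ C → ¬ Adj c v) →
    (∀ S → Disconnects G S → ∣ ∁ S ∣ ≤ ∣ C ∣) → μ ≡ n ∸ ∣ C ∣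
  κ≡n∸∣C∣ C c c∈C isolated bound = ℕₚ.≤-antisym upper (lower (complete? G))
    where
    upper : μ ≤ n ∸ ∣ C ∣
    upper with any? (λ v → v ∈? C ×-dec ¬? (v Finₚ.≟ c))
    ... | yes (v , v∈C , v≢c) = ≤-trans
      (κ≤separator (c , v , x∈p⇒x∉∁p c∈C , x∈p⇒x∉∁p v∈C , λ w → v≢c (Star-preserves (_≡ c)
        (λ { (_ , y∉ , a) refl → contradiction a (isolated (x∉∁p⇒x∈p y∉)) }) w refl)))
      (≤-reflexive (∣∁p∣≡n∸∣p∣ C))
    ... | no alone = ≤-trans κ≤n∸1 (ℕₚ.∸-monoʳ-≤ n
      (≤-trans (p⊆q⇒∣p∣≤∣q∣ C⊆⁅c⁆) (≤-reflexive (∣⁅x⁆∣≡1 c))))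
      where
      C⊆⁅c⁆ : C ⊆ ⁅ c ⁆
      C⊆⁅c⁆ {v} v∈C with v Finₚ.≟ c
      ... | yes refl = x∈⁅x⁆ c
      ... | no v≢c = contradiction (v , v∈C , v≢c) alone

    lower : Dec (Complete G) → n ∸ ∣ C ∣ ≤ μ
    lower (yes com) = ≤-trans (ℕₚ.∸-monoʳ-≤ n (≤-trans (≤-reflexive (sym (∣⁅x⁆∣≡1 c)))
                      (p⊆q⇒∣p∣≤∣q∣ λ x∈ → subst (_∈ C) (sym (x∈⁅y⁆⇒x≡y c x∈)) c∈C)))
                    (≤-reflexive (sym (complete com)))
    lower (no ¬com) with S , ∣S∣≡κ , d ← attained ¬com =
      ≤-trans (ℕₚ.m≤n+o⇒m∸n≤o _ _ (≤-trans (≤-reflexive (sym (∣S∣+∣∁S∣≡n S)))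
        (≤-trans (ℕₚ.+-monoʳ-≤ ∣ S ∣ (bound S d)) (≤-reflexive (ℕₚ.+-comm ∣ S ∣ ∣ C ∣)))))
      (≤-reflexive ∣S∣≡κ)

-- Right neighbours under relabelling.

module _ {n : ℕ} (A : Arrangement n) where
  open Arrangement A
  open Relabel A using (endpoint; label; label-mono)

  RightNeighbourᴬ : Rel (Fin n) 0ℓ
  RightNeighbourᴬ c d = source c < source d × source d < sink c × sink c < sink d

  source-reflects : ∀ {c d} → source c < source d → c Fin.< d
  source-reflects {c} {d} lt with Finₚ.<-cmp c d
  ... | tri< c<d _ _ = c<d
  ... | tri≈ _ refl _ = contradiction lt (<-irrefl refl)
  ... | tri> _ _ d<c = contradiction (source-mono d<c) (ℕₚ.<-asym lt)

  label-reflects : ∀ e f → label e Fin.< label f → endpoint e < endpoint f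
  label-reflects e f lt with ℕₚ.<-cmp (endpoint e) (endpoint f)
  ... | tri< e<f _ _ = e<f
  ... | tri≈ _ e≡f _ = contradiction lt (<-irrefl (cong (toℕ ∘ label) (distinct {e} {f} e≡f)))
  ... | tri> _ _ f<e = contradiction (label-mono f e f<e) (ℕₚ.<-asym lt)

  relabel-rn⁺ : ∀ {c d} → RightNeighbourᴬ c d → RightNeighbour (relabel A) c d
  relabel-rn⁺ {c} {d} (p , q , r) =
    label-mono (inj₁ c) (inj₁ d) p , label-mono (inj₁ d) (inj₂ c) q , label-mono (inj₂ c) (inj₂ d) r

  relabel-rn⁻ : ∀ {c d} → RightNeighbour (relabel A) c d → RightNeighbourᴬ c d
  relabel-rn⁻ {c} {d} (p , q , r) =
    label-reflects (inj₁ c) (inj₁ d) p , label-reflects (inj₁ d) (inj₂ c) q ,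
    label-reflects (inj₂ c) (inj₂ d) r

-- The crossings that survive `ψ`.

module _ {n : ℕ} (C : ChordDiagram n) where
  open ChordDiagram C

  source-mono-≤ : ∀ {c d} → c Fin.≤ d → source c Fin.≤ source d
  source-mono-≤ {c} {d} c≤d with Finₚ.<-cmp c d
  ... | tri< c<d _ _ = ℕₚ.<⇒≤ (source-mono c<d)
  ... | tri≈ _ refl _ = ≤-refl
  ... | tri> _ _ d<c = contradiction c≤d (ℕₚ.<⇒≱ d<c)

  source-cancel-< : ∀ {c d} → source c Fin.< source d → c Fin.< d
  source-cancel-< lt = ℕₚ.≰⇒> λ d≤c → ℕₚ.<⇒≱ lt (source-mono-≤ d≤c)

  Passes : Rel (Fin n) 0ℓ
  Passes c d = ∃[ e ] (d Fin.< e × source e Fin.< sink c)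

  passes? : Decidable Passes
  passes? c d = any? λ e → d Finₚ.<? e ×-dec source e Finₚ.<? sink c

  -- The right neighbours that survive ψ: a source d is moved past sink c
  -- exactly when no later source precedes sink c.
  StrongNeighbour : Rel (Fin n) 0ℓ
  StrongNeighbour c d = RightNeighbour C c d × Passes c d

  passes⇒groupEnd< : ∀ {c d} → Passes c d → groupEnd C d Fin.< sink c
  passes⇒groupEnd< (e , d<e , s<) = ℕₚ.<-trans (groupEnd<source C d<e) s<

  source≤groupEnd : ∀ d → source d Fin.≤ groupEnd C d
  source≤groupEnd d = proj₁ (proj₁ (proj₂ (lastOfGroup C d)))

  -- If no later source precedes `sink c`, all points after `source d` up to `sink c` are sinks. As
  -- `sink c` precedes `sink d`, it then belongs to the group of `d`, whose end cannot come earlier.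
  groupEnd<⇒passes : ∀ {c d} → sink c Fin.< sink d → groupEnd C d Fin.< sink c → Passes c d
  groupEnd<⇒passes {c} {d} c<d end< = decidable-stable (passes? c d) λ ¬p →
    ℕₚ.<⇒≱ end< (proj₂ (proj₂ (lastOfGroup C d)) (sink c)
      (ℕₚ.≤-trans (source≤groupEnd d) (ℕₚ.<⇒≤ end<) , c<d , all-sinks ¬p))
    where
    all-sinks : ¬ Passes c d → ∀ q → source d Fin.< q → q Fin.≤ sink c → IsSink C q
    all-sinks ¬p q d<q q≤ with proj₂ matching q
    ... | inj₂ e , eq = e , eq refl
    ... | inj₁ e , eq with refl ← eq refl = contradiction
      (e , source-cancel-< d<q , ℕₚ.≤∧≢⇒< q≤ λ eq′ → inj₁≢inj₂
        (proj₁ matching {inj₁ e} {inj₂ c} (Finₚ.toℕ-injective eq′))) ¬p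
      where
      inj₁≢inj₂ : ∀ {a b : Fin n} → inj₁ a ≢ inj₂ b
      inj₁≢inj₂ ()

module _ {m : ℕ} (T : ChordDiagram (suc m)) where
  open ChordDiagram T

  -- `moveSources` puts the source of `d` at `2 * g + 1`, where `g` is the end of its group, and the
  -- sink of `c` at twice its old position. The moved source thus precedes the sink exactly when `g`
  -- does, which `Passes` controls.
  ψ-rn⁺ : ∀ {c d} → StrongNeighbour T (inject₁ c) (inject₁ d) → RightNeighbour (ψ T) c d
  ψ-rn⁺ {c} {d} ((c<d , _ , sc<sd) , p) = relabel-rn⁺ (deleteLast (moveSources T))
    ( s≤s (ℕₚ.*-monoʳ-< 2 (groupEnd-mono T (source-cancel-< T c<d)))
    , ℕₚ.≤-trans (ℕₚ.≤-reflexive (sym (ℕₚ.*-suc 2 _))) (ℕₚ.*-monoʳ-≤ 2 (passes⇒groupEnd< T p))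
    , ℕₚ.*-monoʳ-< 2 sc<sd )

  ψ-rn⁻ : ∀ {c d} → RightNeighbour (ψ T) c d → StrongNeighbour T (inject₁ c) (inject₁ d)
  ψ-rn⁻ {c} {d} rn with relabel-rn⁻ (deleteLast (moveSources T)) rn
  ... | c<d , d<sc , sc<sd = (source-mono c<d′ , d<sc′ , sc<sd′) , pass
    where
    c<d′ : inject₁ c Fin.< inject₁ d
    c<d′ = subst₂ _<_ (sym (toℕ-inject₁ c)) (sym (toℕ-inject₁ d))
      (source-reflects (deleteLast (moveSources T)) {c} {d} c<d)

    sc<sd′ : sink (inject₁ c) Fin.< sink (inject₁ d)
    sc<sd′ = ℕₚ.*-cancelˡ-< 2 _ _ sc<sd

    end< : groupEnd T (inject₁ d) Fin.< sink (inject₁ c)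
    end< = ℕₚ.*-cancelˡ-< 2 _ _ (ℕₚ.<-trans (ℕₚ.n<1+n _) d<sc)

    d<sc′ : source (inject₁ d) Fin.< sink (inject₁ c)
    d<sc′ = ℕₚ.≤-<-trans (source≤groupEnd T (inject₁ d)) end<

    pass : Passes T (inject₁ c) (inject₁ d)
    pass = groupEnd<⇒passes T sc<sd′ end<

-- Structure of 1-terminal diagrams.

module _ {m : ℕ} (T : ChordDiagram (suc m)) where
  open ChordDiagram T

  last : Fin (suc m)
  last = fromℕ m

  last-or-inject₁ : ∀ c → c ≢ last → ∃[ c′ ] inject₁ c′ ≡ c
  last-or-inject₁ c c≢last with view c
  ... | ‵fromℕ = contradiction refl c≢last
  ... | ‵inject₁ c′ = c′ , refl

  <⇒≢last : ∀ {c d : Fin (suc m)} → c Fin.< d → c ≢ last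
  <⇒≢last c<d refl = ℕₚ.<⇒≱ c<d (≤fromℕ _)

  StrongCross : Rel (Fin (suc m)) 0ℓ
  StrongCross c d = StrongNeighbour T c d ⊎ StrongNeighbour T d c

  strong⇒cross : ∀ {c d} → StrongCross c d → Cross T c d
  strong⇒cross = Sum.map proj₁ proj₁

  module _ (one-terminal : OneTerminal T) where

    right-neighbour : ∀ {c} → c ≢ last → ∃[ d ] RightNeighbour T c d
    right-neighbour {c} c≢last = decidable-stable (any? (rightNeighbour? T c)) λ none →
      one-terminal c (λ eq → c≢last (Finₚ.toℕ-injective
        (trans (ℕₚ.suc-injective eq) (sym (Finₚ.toℕ-fromℕ m)))))
        λ d rn → none (d , rn)

    -- A right neighbour has a later source and a later sink, so following right neighbours
    -- terminates; by 1-terminality it stops only at the last chord.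
    sink<sink-last : ∀ {c} → c ≢ last → sink c Fin.< sink last
    sink<sink-last {c} = climb (>-wellFounded c)
      where
      climb : ∀ {c} → Acc Fin._>_ c → c ≢ last → sink c Fin.< sink last
      climb (acc rec) c≢last with right-neighbour c≢last
      ... | d , c<d , _ , sc<sd with d Finₚ.≟ last
      ...   | yes refl = sc<sd
      ...   | no d≢last = ℕₚ.<-trans sc<sd (climb (rec (source-cancel-< T c<d)) d≢last)

    -- The sink of c lies between the sources of d and d + 1, and d is
    -- non-terminal, so its own sink comes after the source of d + 1.
    last-crossed : ∀ {c d} → c ≢ last → source d Fin.< sink c → ¬ Passes T c d →
                   RightNeighbour T c d
    last-crossed {c} {d} c≢last d<sc ¬p = source-mono c<d , d<sc , sc<sd
      where
      c<d : c Fin.< d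
      c<d with e , c<e , e<sc , _ ← right-neighbour c≢last =
        ℕₚ.≰⇒> λ d≤c → ¬p (e , ℕₚ.≤-<-trans d≤c (source-cancel-< T c<e) , e<sc)

      sc<sd : sink c Fin.< sink d
      sc<sd with d Finₚ.≟ last
      ... | yes refl = sink<sink-last c≢last
      ... | no d≢last with f , d<f , f<sd , _ ← right-neighbour d≢last =
        ℕₚ.≤-<-trans (ℕₚ.≮⇒≥ λ f<sc → ¬p (f , source-cancel-< T d<f , f<sc)) f<sd

    -- H is the intersection graph of ψ T, known only through its edges.
    module _ (H : Graph m)
             (ψ-cross⁺ : ∀ {c d} → StrongCross (inject₁ c) (inject₁ d) → Graph.Adj H c d)
             (ψ-cross⁻ : ∀ {c d} → Graph.Adj H c d → StrongCross (inject₁ c) (inject₁ d))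
             {μ ν : ℕ} (connG : IsConnectivity (intersectionGraph T) μ)
             (connH : IsConnectivity H ν) where

      -- The upper bound `ν < μ`.

      private
        G = intersectionGraph T

      -- With X the component of u, the last chord x whose source precedes the
      -- sink of some chord of X lies in S and loses all its neighbours in X, so
      -- S without x separates u from x.
      ψ-separator : ∀ {S u} → u ∉ S → last ∉ S → ¬ Star (AdjOutside G S) u last → ν < ∣ S ∣
      ψ-separator {S} {u} u∉S last∉S ¬u-last
        with greatest (λ d → any? λ i →
                        ¬? (i ∈? S) ×-dec joined? G S u i ×-dec source d Finₚ.<? sink i)
                      (u , u , u∉S , ε , source<sink u)
      ... | x , (i , i∉S , u-i , x<si) , max = begin-strict
        ν                   ≤⟨ κ≤separator H connH sep ⟩
        ∣ restrict S⁻ ∣     ≡⟨ ∣restrict∣-∉ S⁻ (last∉S ∘ p─q⊆p S ⁅ x ⁆) ⟨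
        ∣ S - x ∣           <⟨ x∈p⇒∣p-x∣<∣p∣ x∈S ⟩
        ∣ S ∣               ∎
        where
        open ℕₚ.≤-Reasoning
        S⁻ : Subset (suc m)
        S⁻ = S - x

        X : Fin (suc m) → Set
        X w = w ∉ S × Star (AdjOutside G S) u w

        X⇒≢last : ∀ {w} → X w → w ≢ last
        X⇒≢last (_ , u-w) refl = ¬u-last u-w

        unpassed : ∀ {w} → X w → ¬ Passes T w x
        unpassed (w∉S , u-w) (e , x<e , e<sw) = ℕₚ.<⇒≱ x<e (max e (_ , w∉S , u-w , e<sw))

        -- Otherwise a right neighbour of `x` would be a later chord whose source precedes the sink
        -- of a chord of `X`.
        x∉X : ¬ X x
        x∉X Xx with e , x<e , e<sx , _ ← right-neighbour (X⇒≢last Xx) =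
          unpassed Xx (e , source-cancel-< T x<e , e<sx)

        i-x : RightNeighbour T i x
        i-x = last-crossed (X⇒≢last (i∉S , u-i)) x<si (unpassed (i∉S , u-i))

        x∈S : x ∈ S
        x∈S = decidable-stable (x ∈? S) λ x∉S →
          x∉X (x∉S , u-i ◅◅ (i∉S , x∉S , inj₁ i-x) ◅ ε)

        x≢last : x ≢ last
        x≢last refl = last∉S x∈S

        -- Only `x` is newly available to walks in `H`, and a surviving crossing with `x` would make
        -- a chord of `X` pass `x`, by its own source if it comes after `x`.
        step : ∀ {a b} → AdjOutside H (restrict S⁻) a b → X (inject₁ a) → X (inject₁ b)
        step {a} {b} (_ , b∉ , a-b) (a∉S , u-a) with inject₁ b Finₚ.≟ x | ψ-cross⁻ {a} {b} a-b
        ... | no b≢x | cross = b∉S , u-a ◅◅ (a∉S , b∉S , strong⇒cross cross) ◅ ε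
          where
          b∉S : inject₁ b ∉ S
          b∉S b∈S = b∉ (∈-restrict⁺ S⁻ (x∈p∧x≢y⇒x∈p-y b∈S b≢x))
        ... | yes b≡x | inj₁ (_ , p) =
          contradiction (subst (Passes T _) b≡x p) (unpassed (a∉S , u-a))
        ... | yes b≡x | inj₂ ((b<a , _) , _) = contradiction
          (inject₁ a , subst (Fin._< _) b≡x (source-cancel-< T b<a) , source<sink _)
          (unpassed (a∉S , u-a))

        sep : Disconnects H (restrict S⁻)
        sep with last-or-inject₁ u (X⇒≢last (u∉S , ε)) | last-or-inject₁ x x≢last
        ... | u′ , u′≡u | x′ , x′≡x = u′ , x′ ,
          (λ u′∈ → u∉S (subst (_∈ S) u′≡u (p─q⊆p S ⁅ x ⁆ (∈-restrict⁻ S⁻ u′∈)))) ,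
          (λ x′∈ → x∉p-x S (subst (_∈ S⁻) x′≡x (∈-restrict⁻ S⁻ x′∈))) ,
          λ w → x∉X (subst X x′≡x (Star-preserves (X ∘ inject₁) step w
            (subst X (sym u′≡u) (u∉S , ε))))

      -- If `last ∈ S`, walks of `H` avoiding `restrict S` lift to `G`, so dropping the last chord
      -- leaves a separator with one element fewer. Otherwise `last` is not joined to both `u` and
      -- `v`, and `ψ-separator` applies to one of them.
      ν<separator : ∀ {S} → Disconnects G S → ν < ∣ S ∣
      ν<separator {S} (u , v , u∉S , v∉S , ¬uv) with last ∈? S
      ... | no last∉S with joined? G S u last
      ...   | no ¬u-last = ψ-separator u∉S last∉S ¬u-last
      ...   | yes u-last = ψ-separator v∉S last∉S λ v-last →
        ¬uv (u-last ◅◅ reverse (λ (p , q , a) → q , p , Graph.symmetric G a) v-last)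
      ν<separator {S} (u , v , u∉S , v∉S , ¬uv) | yes last∈S
        with last-or-inject₁ u (λ { refl → u∉S last∈S })
           | last-or-inject₁ v (λ { refl → v∉S last∈S })
      ... | u′ , refl | v′ , refl = ≤-trans (s≤s (κ≤separator H connH
        (u′ , v′ , u∉S ∘ ∈-restrict⁻ S , v∉S ∘ ∈-restrict⁻ S , λ w → ¬uv (gmap inject₁ step w))))
        (≤-reflexive (sym (∣restrict∣-∈ S last∈S)))
        where
        step : ∀ {a b} → AdjOutside H (restrict S) a b → AdjOutside G S (inject₁ a) (inject₁ b)
        step {a} {b} (a∉ , b∉ , a-b) =
          a∉ ∘ ∈-restrict⁺ S , b∉ ∘ ∈-restrict⁺ S , strong⇒cross (ψ-cross⁻ {a} {b} a-b)

      ν<μ : 1 ≤ m → ν < μ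
      ν<μ 1≤m = by-cases (complete? G)
        where
        open IsConnectivity connG
        by-cases : Dec (Complete G) → ν < μ
        -- `G` has one vertex more than `H`, so the value `m` of the complete graph exceeds every
        -- possible `ν`.
        by-cases (yes com) = begin-strict
          ν      ≤⟨ κ≤n∸1 H connH ⟩
          m ∸ 1  <⟨ ℕₚ.∸-monoʳ-< (s≤s z≤n) 1≤m ⟩
          m      ≡⟨ complete com ⟨
          μ      ∎
          where open ℕₚ.≤-Reasoning
        by-cases (no ¬com) with S , ∣S∣≡κ , d ← attained ¬com =
          ≤-trans (ν<separator d) (≤-reflexive ∣S∣≡κ)

      -- The lower bound `suc m ≤ ν + 2 * k`.

      module _ {k : ℕ} (1≤k : 1 ≤ k) (k≤n : k ≤ suc m)
               (bound : ∀ S → Disconnects G S → suc m ∸ k ≤ ∣ S ∣) where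

        -- The chord `a` alone is one of two uncrossed sets; an empty `p` separates nothing, and
        -- there `1 ≤ k` is used.
        nonneighbours-≤ : ∀ {a} (p : Subset (suc m)) → a ∉ p →
          (∀ {y} → y ∈ p → ¬ Cross T a y) → 1 + ∣ p ∣ ≤ k
        nonneighbours-≤ {a} p a∉p nonadj with nonempty? p
        ... | no empty = subst (λ q → suc ∣ q ∣ ≤ k) (sym (Empty-unique empty))
          (subst (λ x → suc x ≤ k) (sym (∣⊥∣≡0 (suc m))) 1≤k)
        ... | yes nonempty = subst (λ x → x + ∣ p ∣ ≤ k) (∣⁅x⁆∣≡1 a)
          (nonadjacent-sets-≤ G k≤n bound ⁅ a ⁆ p (a , x∈⁅x⁆ a) nonempty
            (λ x∈a x∈p → a∉p (subst (_∈ p) (x∈⁅y⁆⇒x≡y a x∈a) x∈p))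
            (λ x∈a y∈p → subst (λ x → ¬ Cross T x _) (sym (x∈⁅y⁆⇒x≡y a x∈a)) (nonadj y∈p)))

        -- Either the last chord crosses a and a loses no neighbour in B under ψ,
        -- or the last chord can stand in for the one neighbour that a loses.
        side-≤ : ∀ {a} (B : Subset (suc m)) → a ≢ last → a ∉ B → last ∉ B →
          (∀ {y} → y ∈ B → ¬ StrongNeighbour T a y) →
          (∀ {y} → y ∈ B → ¬ RightNeighbour T y a) → 1 + ∣ B ∣ ≤ k
        side-≤ {a} B a≢last a∉B last∉B ¬strong ¬left
          with greatest (λ d → source d Finₚ.<? sink a) (a , source<sink a)
        ... | r , r<sa , max = ≤-trans (s≤s ∣B∣≤∣Y∣) (nonneighbours-≤ Y a∉Y nonadj)
          where
          -- `r` is the only right neighbour that `a` can lose: one before `r` is strong because of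
          -- `r`. Removing `r` costs at most one chord, which `last` makes up for.
          Y : Subset (suc m)
          Y = (B ∪ ⁅ last ⁆) - r

          ∣B∣≤∣Y∣ : ∣ B ∣ ≤ ∣ Y ∣
          ∣B∣≤∣Y∣ = s≤s⁻¹ (begin
            suc ∣ B ∣              ≡⟨ ℕₚ.+-comm 1 ∣ B ∣ ⟩
            ∣ B ∣ + 1              ≡⟨ cong (∣ B ∣ +_) (∣⁅x⁆∣≡1 last) ⟨
            ∣ B ∣ + ∣ ⁅ last ⁆ ∣   ≤⟨ ∣p∣+∣q∣≤∣p∪q∣ B ⁅ last ⁆ disj ⟩
            ∣ B ∪ ⁅ last ⁆ ∣       ≤⟨ ∣p∣≤1+∣p-x∣ (B ∪ ⁅ last ⁆) r ⟩
            suc ∣ Y ∣              ∎)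
            where
            open ℕₚ.≤-Reasoning
            disj : ∀ {x} → x ∈ B → x ∉ ⁅ last ⁆
            disj x∈B x∈l = last∉B (subst (_∈ B) (x∈⁅y⁆⇒x≡y last x∈l) x∈B)

          Y⁻ : ∀ {y} → y ∈ Y → y ≢ r × (y ∈ B ⊎ y ≡ last)
          Y⁻ {y} y∈Y = (λ { refl → x∉p-x (B ∪ ⁅ last ⁆) y∈Y }) ,
            Sum.map₂ (x∈⁅y⁆⇒x≡y last) (x∈p∪q⁻ B ⁅ last ⁆ (p─q⊆p _ ⁅ r ⁆ y∈Y))

          a∉Y : a ∉ Y
          a∉Y a∈Y = [ a∉B , a≢last ]′ (proj₂ (Y⁻ a∈Y))

          nonadj : ∀ {y} → y ∈ Y → ¬ Cross T a y
          nonadj y∈Y a-y with Y⁻ y∈Y | a-y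
          ... | _ , inj₂ refl | inj₂ (l<a , _) = <⇒≢last (source-cancel-< T l<a) refl
          ... | _ , inj₁ y∈B | inj₂ y-a = ¬left y∈B y-a
          ... | y≢r , y∈B⁺ | inj₁ a-y@(_ , y<a , _)
            with y<r ← ℕₚ.≤∧≢⇒< (max _ y<a) (y≢r ∘ Finₚ.toℕ-injective) | y∈B⁺
          ...   | inj₁ y∈B = ¬strong y∈B (a-y , r , y<r , r<sa)
          ...   | inj₂ refl = <⇒≢last y<r refl

        -- If b crosses a chord of A to its left, then P (chords of A whose sink
        -- comes before the source of b + 1) is separated in T from Y (chords
        -- after b), and b is separated from Q (chords of A that cover b).
        two-sides-≤ : (A B W : Subset (suc m)) → (∀ {x} → x ∈ A → x ∉ B) → last ∉ A → last ∉ B →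
          (∀ {x y} → x ∈ A → y ∈ B → ¬ StrongCross x y) →
          (∀ {x} → x ∈ W → x ∈ A ⊎ x ∈ B ⊎ x ≡ last) →
          ∀ {a b} → a ∈ A → b ∈ B → a Fin.< b → (∀ {y} → y ∈ B → b Fin.≤ y) → ∣ W ∣ ≤ k + k
        two-sides-≤ A B W disj last∉A last∉B nonadj cover {a} {b} a∈A b∈B a<b b-min
          with any? (λ i → i ∈? A ×-dec rightNeighbour? T i b)
        ... | no none = begin
          ∣ W ∣                         ≤⟨ p⊆q⇒∣p∣≤∣q∣ W⊆ ⟩
          ∣ A ∪ (B ∪ ⁅ last ⁆) ∣        ≤⟨ ∣p∪q∣≤∣p∣+∣q∣ A (B ∪ ⁅ last ⁆) ⟩
          ∣ A ∣ + ∣ B ∪ ⁅ last ⁆ ∣      ≤⟨ ℕₚ.+-monoʳ-≤ ∣ A ∣ (∣p∪q∣≤∣p∣+∣q∣ B ⁅ last ⁆) ⟩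
          ∣ A ∣ + (∣ B ∣ + ∣ ⁅ last ⁆ ∣) ≡⟨ cong (λ x → ∣ A ∣ + (∣ B ∣ + x)) (∣⁅x⁆∣≡1 last) ⟩
          ∣ A ∣ + (∣ B ∣ + 1)           ≡⟨ cong (∣ A ∣ +_) (ℕₚ.+-comm ∣ B ∣ 1) ⟩
          -- The bound on `B` keeps its extra unit, which counts the last chord.
          ∣ A ∣ + (1 + ∣ B ∣)           ≤⟨ ℕₚ.+-mono-≤ (ℕₚ.<⇒≤ ∣A∣<k) ∣B∣<k ⟩
          k + k                         ∎
          where
          open ℕₚ.≤-Reasoning
          W⊆ : W ⊆ A ∪ (B ∪ ⁅ last ⁆)
          W⊆ x∈W with cover x∈W
          ... | inj₁ x∈A = x∈p∪q⁺ (inj₁ x∈A)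
          ... | inj₂ (inj₁ x∈B) = x∈p∪q⁺ (inj₂ (x∈p∪q⁺ (inj₁ x∈B)))
          ... | inj₂ (inj₂ refl) = x∈p∪q⁺ (inj₂ (x∈p∪q⁺ (inj₂ (x∈⁅x⁆ last))))

          -- `side-≤` compares `b` with `A`, as no chord of `A` has `b` as right neighbour, and then
          -- `a` with `B`, as all of `B` comes after `a`.
          ∣A∣<k : 1 + ∣ A ∣ ≤ k
          ∣A∣<k = side-≤ A (λ { refl → last∉B b∈B }) (λ b∈A → disj b∈A b∈B) last∉A
            (λ y∈A s → nonadj y∈A b∈B (inj₂ s)) (λ y∈A rn → none (_ , y∈A , rn))

          ∣B∣<k : 1 + ∣ B ∣ ≤ k
          ∣B∣<k = side-≤ B (<⇒≢last a<b) (disj a∈A) last∉B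
            (λ y∈B s → nonadj a∈A y∈B (inj₁ s))
            (λ y∈B (y<a , _) → ℕₚ.<⇒≱ (ℕₚ.<-trans (source-cancel-< T y<a) a<b) (b-min y∈B))
        ... | yes (i , i∈A , i-b) = begin
          ∣ W ∣                                  ≤⟨ p⊆q⇒∣p∣≤∣q∣ cover′ ⟩
          ∣ (P ∪ Y) ∪ (⁅ b ⁆ ∪ Q) ∣              ≤⟨ ∣p∪q∣≤∣p∣+∣q∣ (P ∪ Y) (⁅ b ⁆ ∪ Q) ⟩
          ∣ P ∪ Y ∣ + ∣ ⁅ b ⁆ ∪ Q ∣              ≤⟨ ℕₚ.+-mono-≤ (∣p∪q∣≤∣p∣+∣q∣ P Y)
                                                                (∣p∪q∣≤∣p∣+∣q∣ ⁅ b ⁆ Q) ⟩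
          (∣ P ∣ + ∣ Y ∣) + (∣ ⁅ b ⁆ ∣ + ∣ Q ∣)  ≡⟨ cong (λ x → (∣ P ∣ + ∣ Y ∣) + (x + ∣ Q ∣))
                                                         (∣⁅x⁆∣≡1 b) ⟩
          (∣ P ∣ + ∣ Y ∣) + (1 + ∣ Q ∣)          ≤⟨ ℕₚ.+-mono-≤ P-Y b-Q ⟩
          k + k                                  ∎
          where
          open ℕₚ.≤-Reasoning
          b<last : b Fin.< last
          b<last = ℕₚ.≤∧≢⇒< (≤fromℕ b) λ eq → last∉B (subst (_∈ B) (Finₚ.toℕ-injective eq) b∈B)

          P? : U.Decidable λ x → x ∈ A × ¬ Passes T x b
          P? x = x ∈? A ×-dec ¬? (passes? T x b)

          Q? : U.Decidable λ x → x ∈ A × x Fin.< b × Passes T x b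
          Q? x = x ∈? A ×-dec x Finₚ.<? b ×-dec passes? T x b

          P Q Y : Subset (suc m)
          P = filter P?
          Q = filter Q?
          Y = filter (b Finₚ.<?_)

          -- A chord after `b` passes `b` by its own source.
          P≤b : ∀ {x} → x ∈ P → ¬ b Fin.< x
          P≤b x∈P b<x = proj₂ (∈-filter⁻ P? x∈P) (_ , b<x , source<sink _)

          P-Y : ∣ P ∣ + ∣ Y ∣ ≤ k
          P-Y = nonadjacent-sets-≤ G k≤n bound P Y
            -- `i` crosses `b` but not strongly, so it does not pass `b` and `P` is nonempty.
            (i , ∈-filter⁺ P? (i∈A , λ p → nonadj i∈A b∈B (inj₁ (i-b , p))))
            (last , ∈-filter⁺ (b Finₚ.<?_) b<last)
            (λ x∈P x∈Y → P≤b x∈P (∈-filter⁻ (b Finₚ.<?_) x∈Y))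
            λ { x∈P y∈Y (inj₁ (_ , y<sx , _)) →
                  proj₂ (∈-filter⁻ P? x∈P) (_ , ∈-filter⁻ (b Finₚ.<?_) y∈Y , y<sx)
              ; x∈P y∈Y (inj₂ (y<x , _)) →
                  P≤b x∈P (ℕₚ.<-trans (∈-filter⁻ (b Finₚ.<?_) y∈Y) (source-cancel-< T y<x)) }

          b-Q : 1 + ∣ Q ∣ ≤ k
          b-Q = nonneighbours-≤ Q (λ b∈Q → disj (proj₁ (∈-filter⁻ Q? b∈Q)) b∈B) nonadj-b
            where
            nonadj-b : ∀ {y} → y ∈ Q → ¬ Cross T b y
            nonadj-b y∈Q b-y with ∈-filter⁻ Q? y∈Q | b-y
            ... | _ , y<b , _ | inj₁ (b<y , _) = ℕₚ.<-asym y<b (source-cancel-< T b<y)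
            ... | y∈A , _ , p | inj₂ y-b = nonadj y∈A b∈B (inj₁ (y-b , p))

          -- A chord of `W` before `b` lies in `A`, because `b` is the first chord of `B`; passing
          -- `b` decides between `Q` and `P`.
          cover′ : W ⊆ (P ∪ Y) ∪ (⁅ b ⁆ ∪ Q)
          cover′ {x} x∈W with Finₚ.<-cmp x b | cover x∈W
          ... | tri≈ _ refl _ | _ = x∈p∪q⁺ (inj₂ (x∈p∪q⁺ (inj₁ (x∈⁅x⁆ b))))
          ... | tri> _ _ b<x | _ = x∈p∪q⁺ (inj₁ (x∈p∪q⁺ (inj₂ (∈-filter⁺ (b Finₚ.<?_) b<x))))
          ... | tri< x<b _ _ | inj₂ (inj₁ x∈B) = contradiction (b-min x∈B) (ℕₚ.<⇒≱ x<b)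
          ... | tri< x<b _ _ | inj₂ (inj₂ refl) = contradiction refl (<⇒≢last x<b)
          ... | tri< x<b _ _ | inj₁ x∈A with passes? T x b
          ...   | no ¬p = x∈p∪q⁺ (inj₁ (x∈p∪q⁺ (inj₁ (∈-filter⁺ P? (x∈A , ¬p)))))
          ...   | yes p = x∈p∪q⁺ (inj₂ (x∈p∪q⁺ (inj₂ (∈-filter⁺ Q? (x∈A , x<b , p)))))

        -- `A` is the component of `u` and `B` the rest of what `S` leaves, both viewed in `T`. With
        -- the last chord they cover the complement of `S⁺`, which `two-sides-≤` bounds.
        ψ-separator-≥ : ∀ {S} → Disconnects H S → suc m ≤ ∣ S ∣ + (k + k)
        ψ-separator-≥ {S} (u , v , u∉S , v∉S , ¬uv) = begin
          suc m                ≡⟨ ∣S∣+∣∁S∣≡n S⁺ ⟨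
          ∣ S⁺ ∣ + ∣ ∁ S⁺ ∣    ≤⟨ ℕₚ.+-mono-≤ ∣S⁺∣≤∣S∣ ∣∁S⁺∣≤2k ⟩
          ∣ S ∣ + (k + k)      ∎
          where
          open ℕₚ.≤-Reasoning
          image? : {Q : Fin m → Set} → U.Decidable Q →
                   U.Decidable λ x → ∃[ i ] (inject₁ i ≡ x × Q i)
          image? Q? x = any? λ i → inject₁ i Finₚ.≟ x ×-dec Q? i

          S? : U.Decidable λ x → ∃[ i ] (inject₁ i ≡ x × i ∈ S)
          S? = image? (_∈? S)

          A? : U.Decidable λ x → ∃[ i ] (inject₁ i ≡ x × i ∉ S × Star (AdjOutside H S) u i)
          A? = image? λ i → ¬? (i ∈? S) ×-dec joined? H S u i

          B? : U.Decidable λ x → ∃[ i ] (inject₁ i ≡ x × i ∉ S × ¬ Star (AdjOutside H S) u i)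
          B? = image? λ i → ¬? (i ∈? S) ×-dec ¬? (joined? H S u i)

          S⁺ A B : Subset (suc m)
          S⁺ = filter S?
          A = filter A?
          B = filter B?

          ∣S⁺∣≤∣S∣ : ∣ S⁺ ∣ ≤ ∣ S ∣
          ∣S⁺∣≤∣S∣ = ≤-trans
            (≤-reflexive (∣restrict∣-∉ S⁺ λ l∈ →
              let _ , eq , _ = ∈-filter⁻ S? l∈ in fromℕ≢inject₁ (sym eq)))
            (p⊆q⇒∣p∣≤∣q∣ λ i∈ → let _ , eq , i∈S = ∈-filter⁻ S? (∈-restrict⁻ S⁺ i∈) in
              subst (_∈ S) (Finₚ.inject₁-injective eq) i∈S)

          last∉A : last ∉ A
          last∉A l∈ = let _ , eq , _ = ∈-filter⁻ A? l∈ in fromℕ≢inject₁ (sym eq)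

          last∉B : last ∉ B
          last∉B l∈ = let _ , eq , _ = ∈-filter⁻ B? l∈ in fromℕ≢inject₁ (sym eq)

          disj : ∀ {x} → x ∈ A → x ∉ B
          disj x∈A x∈B with ∈-filter⁻ A? x∈A | ∈-filter⁻ B? x∈B
          ... | i , refl , _ , u-i | j , eq , _ , ¬u-j
            with refl ← Finₚ.inject₁-injective eq = ¬u-j u-i

          nonadj : ∀ {x y} → x ∈ A → y ∈ B → ¬ StrongCross x y
          nonadj x∈A y∈B x-y with ∈-filter⁻ A? x∈A | ∈-filter⁻ B? y∈B
          ... | i , refl , i∉S , u-i | j , refl , j∉S , ¬u-j =
            ¬u-j (u-i ◅◅ (i∉S , j∉S , ψ-cross⁺ {i} {j} x-y) ◅ ε)

          ∁S⁺⇒∉S : ∀ {i} → inject₁ i ∈ ∁ S⁺ → i ∉ S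
          ∁S⁺⇒∉S {i} i∈ i∈S = x∈∁p⇒x∉p i∈ (∈-filter⁺ S? (i , refl , i∈S))

          cover : ∀ {x} → x ∈ ∁ S⁺ → x ∈ A ⊎ x ∈ B ⊎ x ≡ last
          cover {x} x∈ with x Finₚ.≟ last
          ... | yes x≡last = inj₂ (inj₂ x≡last)
          ... | no x≢last with i , refl ← last-or-inject₁ x x≢last | joined? H S u i
          ...   | yes u-i = inj₁ (∈-filter⁺ A? (i , refl , ∁S⁺⇒∉S x∈ , u-i))
          ...   | no ¬u-i = inj₂ (inj₁ (∈-filter⁺ B? (i , refl , ∁S⁺⇒∉S x∈ , ¬u-i)))

          ∣∁S⁺∣≤2k : ∣ ∁ S⁺ ∣ ≤ k + k
          ∣∁S⁺∣≤2k with least-element A (inject₁ u , ∈-filter⁺ A? (u , refl , u∉S , ε))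
                      | least-element B (inject₁ v , ∈-filter⁺ B? (v , refl , v∉S , ¬uv))
          -- The side with the earlier first chord takes the role of the first set.
          ... | a , a∈A , a-min | b , b∈B , b-min with Finₚ.<-cmp a b
          ...   | tri< a<b _ _ =
            two-sides-≤ A B (∁ S⁺) disj last∉A last∉B nonadj cover a∈A b∈B a<b b-min
          ...   | tri≈ _ refl _ = contradiction b∈B (disj a∈A)
          ...   | tri> _ _ b<a = two-sides-≤ B A (∁ S⁺) (λ x∈B x∈A → disj x∈A x∈B) last∉B last∉A
            (λ x∈B y∈A x-y → nonadj y∈A x∈B (Sum.swap x-y))
            (λ x∈ → [ inj₂ ∘ inj₁ , [ inj₁ , inj₂ ∘ inj₂ ]′ ]′ (cover x∈)) b∈B a∈A b<a a-min

      n≤ν+2k : ∀ {k} → 1 ≤ k → k < suc m → μ ≡ suc m ∸ k → suc m ≤ ν + 2 * k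
      n≤ν+2k {k} 1≤k k<n μ≡ = subst (λ x → suc m ≤ ν + (k + x)) (sym (ℕₚ.+-identityʳ k))
        (by-cases (complete? H))
        where
        open IsConnectivity connH
        by-cases : Dec (Complete H) → suc m ≤ ν + (k + k)
        -- A complete `H` has connectivity `m ∸ 1`, and `2 ≤ k + k` makes up the missing two.
        by-cases (yes com) = begin
          suc m            ≤⟨ s≤s (ℕₚ.m≤n+m∸n m 1) ⟩
          2 + (m ∸ 1)      ≡⟨ ℕₚ.+-comm 2 (m ∸ 1) ⟩
          m ∸ 1 + 2        ≤⟨ ℕₚ.+-monoʳ-≤ (m ∸ 1) (ℕₚ.+-mono-≤ 1≤k 1≤k) ⟩
          m ∸ 1 + (k + k)  ≡⟨ cong (_+ (k + k)) (complete com) ⟨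
          ν + (k + k)      ∎
          where open ℕₚ.≤-Reasoning
        by-cases (no ¬com) with S , ∣S∣≡κ , d ← attained ¬com =
          ≤-trans (ψ-separator-≥ 1≤k (ℕₚ.<⇒≤ k<n)
            (λ S d → ≤-trans (≤-reflexive (sym μ≡)) (κ≤separator G connG d)) d)
          (≤-reflexive (cong (_+ (k + k)) ∣S∣≡κ))

-- The extremal diagrams: kinds of chords and when they cross.

Kind : Set
Kind = Fin 5

-- The numbering follows the order of sources. With finitely many kinds, statements quantified over
-- kinds are settled by evaluating a decision procedure.
pattern early    = zero
pattern spanning = suc zero
pattern long     = suc (suc zero)
pattern pivot    = suc (suc (suc zero))
pattern final    = suc (suc (suc (suc zero)))

BeforePivot : Kind → Set
BeforePivot k = toℕ k < 3

beforePivot? : U.Decidable BeforePivot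
beforePivot? k = toℕ k ℕₚ.<? 3

-- The kinds of two chords in the order of their sources: only the kinds
-- before pivot are repeated.
_⊑_ : Rel Kind 0ℓ
k ⊑ l = k Fin.< l ⊎ (k ≡ l × BeforePivot k)

_⊑?_ : Decidable _⊑_
k ⊑? l = k Finₚ.<? l ⊎-dec (k Finₚ.≟ l ×-dec beforePivot? k)

-- Endpoints are ordered by level first and by index second: all sources but
-- the last, early sinks, the last source, spanning sinks, the pivot sink, long
-- sinks, the last sink.
sourceLevel sinkLevel : Kind → Fin 7
sourceLevel = lookup (# 0 ∷ # 0 ∷ # 0 ∷ # 0 ∷ # 2 ∷ [])
sinkLevel   = lookup (# 1 ∷ # 3 ∷ # 5 ∷ # 4 ∷ # 6 ∷ [])

sourceLevel<sinkLevel : ∀ k → sourceLevel k Fin.< sinkLevel k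
sourceLevel<sinkLevel = from-yes (all? λ k → sourceLevel k Finₚ.<? sinkLevel k)

sourceLevel-mono : ∀ k l → k ⊑ l → sourceLevel k Fin.≤ sourceLevel l
sourceLevel-mono = from-yes (all? λ k → all? λ l →
  k ⊑? l →-dec sourceLevel k Finₚ.≤? sourceLevel l)

final-maximal : ∀ k → ¬ (final ⊑ k)
final-maximal = from-yes (all? λ k → ¬? (final ⊑? k))

⊑-asym : ∀ k l → k Fin.< l → ¬ (l ⊑ k)
⊑-asym = from-yes (all? λ k → all? λ l → k Finₚ.<? l →-dec ¬? (l ⊑? k))

sourceLevel≢sinkLevel : ∀ k l → sourceLevel k ≢ sinkLevel l
sourceLevel≢sinkLevel = from-yes (all? λ k → all? λ l → ¬? (sourceLevel k Finₚ.≟ sinkLevel l))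

-- Crossing read off the levels, for a chord of kind `k` followed by one of kind `l`. Sinks are
-- compared weakly because sinks of equal level are ordered by index.
Meets : Rel Kind 0ℓ
Meets k l = sourceLevel l Fin.< sinkLevel k × sinkLevel k Fin.≤ sinkLevel l

meets? : Decidable Meets
meets? k l = sourceLevel l Finₚ.<? sinkLevel k ×-dec sinkLevel k Finₚ.≤? sinkLevel l

-- The source of 1-terminality: early and spanning chords have the pivot as right neighbour, long
-- chords and the pivot have the last chord.
meets-pivot-or-final : ∀ k → k ≢ final → (BeforePivot k × Meets k pivot) ⊎ Meets k final
meets-pivot-or-final = from-yes (all? λ k → ¬? (k Finₚ.≟ final) →-dec
  ((beforePivot? k ×-dec meets? k pivot) ⊎-dec meets? k final))

-- The later source that must precede the sink of k is that of the pivot or of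
-- the final chord.  The latter is absent from ψ T, so pairs involving it are
-- harmlessly counted as meeting.
ψ-Meets : Rel Kind 0ℓ
ψ-Meets k l = l ≡ final ⊎ (Meets k l ×
  ((BeforePivot l × sourceLevel pivot Fin.< sinkLevel k) ⊎ sourceLevel final Fin.< sinkLevel k))

ψ-meets? : Decidable ψ-Meets
ψ-meets? k l = l Finₚ.≟ final ⊎-dec (meets? k l ×-dec
  ((beforePivot? l ×-dec sourceLevel pivot Finₚ.<? sinkLevel k) ⊎-dec
   sourceLevel final Finₚ.<? sinkLevel k))

Apart : Rel Kind 0ℓ → Rel Kind 0ℓ
Apart M k l = (k ⊑ l × ¬ M k l) ⊎ (l ⊑ k × ¬ M l k)

apart? : ∀ {M} → Decidable M → Decidable (Apart M)
apart? M? k l = (k ⊑? l ×-dec ¬? (M? k l)) ⊎-dec (l ⊑? k ×-dec ¬? (M? l k))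

-- The components with more than one kind of the non-crossing relation: two for `T`, around the
-- pivot and the final chord, and a single one for `ψ T`.
pivot-class final-class ψ-class : Kind → Bool
pivot-class = lookup (false ∷ false ∷ true ∷ true ∷ false ∷ [])
final-class = lookup (true ∷ false ∷ false ∷ false ∷ true ∷ [])
ψ-class     = lookup (true ∷ false ∷ true ∷ true ∷ false ∷ [])

Closed : Rel Kind 0ℓ → (Kind → Bool) → Set
Closed M f = ∀ k l → Apart M k l → f k ≡ true → f l ≡ true

closed? : ∀ {M} → Decidable M → ∀ f → Dec (Closed M f)
closed? M? f = all? λ k → all? λ l → apart? M? k l →-dec (f k Bool.≟ true →-dec f l Bool.≟ true)

pivot-class-closed : Closed Meets pivot-class
pivot-class-closed = from-yes (closed? meets? pivot-class)

final-class-closed : Closed Meets final-class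
final-class-closed = from-yes (closed? meets? final-class)

ψ-class-closed : Closed ψ-Meets ψ-class
ψ-class-closed = from-yes (closed? ψ-meets? ψ-class)

apart⇒class : ∀ k l → Apart Meets k l → pivot-class k ≡ true ⊎ final-class k ≡ true
apart⇒class = from-yes (all? λ k → all? λ l → apart? meets? k l →-dec
  (pivot-class k Bool.≟ true ⊎-dec final-class k Bool.≟ true))

apart⇒ψ-class : ∀ k l → Apart ψ-Meets k l → ψ-class k ≡ true
apart⇒ψ-class = from-yes (all? λ k → all? λ l → apart? ψ-meets? k l →-dec ψ-class k Bool.≟ true)

-- Connectivity from classes of kinds.

class : ∀ {n} → (Kind → Bool) → (Fin n → Kind) → Subset n
class f kind = tabulate (f ∘ kind)

module _ {n : ℕ} (f : Kind → Bool) (kind : Fin n → Kind) where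

  ∈-class⁺ : ∀ {i} → f (kind i) ≡ true → i ∈ class f kind
  ∈-class⁺ {i} eq = lookup⇒[]= i _ (trans (lookup∘tabulate (f ∘ kind) i) eq)

  ∈-class⁻ : ∀ {i} → i ∈ class f kind → f (kind i) ≡ true
  ∈-class⁻ {i} i∈ = trans (sym (lookup∘tabulate (f ∘ kind) i)) ([]=⇒lookup i∈)

-- Two separated vertices do not cross, so the first has its kind in `f` or `g`; by `∁separator⊆`
-- everything left by the separator lies in that class, and the class of `f` is the larger.
κ-by-kind : ∀ {n} (G : Graph n) {μ} → IsConnectivity G μ →
  (kind : Fin n → Kind) (M : Rel Kind 0ℓ) →
  (∀ {x y} → x ≢ y → ¬ Graph.Adj G x y → Apart M (kind x) (kind y)) →
  ∀ f g → Closed M f → Closed M g → (∀ k l → Apart M k l → f k ≡ true ⊎ g k ≡ true) →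
  ∣ class g kind ∣ ≤ ∣ class f kind ∣ →
  ∀ c → f (kind c) ≡ true → (∀ {v} → f (kind v) ≡ true → ¬ Graph.Adj G c v) →
  μ ≡ n ∸ ∣ class f kind ∣
κ-by-kind G isConn kind M apart f g closed-f closed-g total g≤f c fc isolated =
  κ≡n∸∣C∣ G isConn (class f kind) c (∈-class⁺ f kind fc) (isolated ∘ ∈-class⁻ f kind) bound
  where
  contains : ∀ {h} → Closed M h → ∀ {S u v} → u ∉ S → v ∉ S → ¬ Star (AdjOutside G S) u v →
    h (kind u) ≡ true → ∁ S ⊆ class h kind
  contains {h} closed u∉S v∉S ¬uv hu = ∁separator⊆ G u∉S v∉S ¬uv (class h kind) (∈-class⁺ h kind hu)
    λ x∈ x≢y ¬a → ∈-class⁺ h kind (closed _ _ (apart x≢y ¬a) (∈-class⁻ h kind x∈))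

  bound : ∀ S → Disconnects G S → ∣ ∁ S ∣ ≤ ∣ class f kind ∣
  bound S (u , v , u∉S , v∉S , ¬uv)
    with total _ _ (apart {u} {v} (λ { refl → ¬uv ε }) λ a → ¬uv ((u∉S , v∉S , a) ◅ ε))
  ... | inj₁ fu = p⊆q⇒∣p∣≤∣q∣ (contains closed-f u∉S v∉S ¬uv fu)
  ... | inj₂ gu = ≤-trans (p⊆q⇒∣p∣≤∣q∣ (contains closed-g u∉S v∉S ¬uv gu)) g≤f

-- Realising a sequence of kinds by a diagram.

module _ {n : ℕ} where

  position : Fin 7 → Fin n → ℕ
  position a i = toℕ (combine a i)

  position-mono : ∀ {a b} {i j : Fin n} → a Fin.≤ b → i Fin.< j → position a i < position b j
  position-mono {a} {b} {i} {j} a≤b i<j =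
    subst₂ _<_ (sym (Finₚ.toℕ-combine a i)) (sym (Finₚ.toℕ-combine b j)) (ℕₚ.+-mono-≤-< (ℕₚ.*-monoʳ-≤ n a≤b) i<j)

  position-cancel : ∀ {a b} {i j : Fin n} → position a i < position b j → a Fin.≤ b
  position-cancel {i = i} {j} lt = ℕₚ.≮⇒≥ λ b<a → ℕₚ.<-asym lt (Finₚ.combine-monoˡ-< j i b<a)

-- The computations of connectivity see the diagram only through these properties.
record Realises {n} (T : ChordDiagram n) (kind : Fin n → Kind) : Set where
  open ChordDiagram T
  field
    ordered      : ∀ {i j} → i Fin.< j → kind i ⊑ kind j
    source<sink⁺ : ∀ {i j} → sourceLevel (kind j) Fin.< sinkLevel (kind i) → source j Fin.< sink i
    source<sink⁻ : ∀ {i j} → source j Fin.< sink i → sourceLevel (kind j) Fin.< sinkLevel (kind i)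
    rn⁺          : ∀ {i j} → i Fin.< j → Meets (kind i) (kind j) → RightNeighbour T i j
    rn⁻          : ∀ {i j} → RightNeighbour T i j → kind i ⊑ kind j × Meets (kind i) (kind j)

module _ {n : ℕ} (kind : Fin n → Kind) (ordered : ∀ {i j} → i Fin.< j → kind i ⊑ kind j) where

  before : ∀ {i j} → i ≢ j → ¬ (kind j ⊑ kind i) → i Fin.< j
  before {i} {j} i≢j ¬ji with Finₚ.<-cmp i j
  ... | tri< i<j _ _ = i<j
  ... | tri≈ _ i≡j _ = contradiction i≡j i≢j
  ... | tri> _ _ j<i = contradiction (ordered j<i) ¬ji

  arrangement : Arrangement n
  arrangement = record
    { source = src
    ; sink = snk
    ; source<sink = λ i → Finₚ.combine-monoˡ-< i i (sourceLevel<sinkLevel (kind i))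
    ; source-mono = λ i<j → position-mono (sourceLevel-mono _ _ (ordered i<j)) i<j
    ; distinct = distinct }
    where
    src snk : Fin n → ℕ
    src i = position (sourceLevel (kind i)) i
    snk i = position (sinkLevel (kind i)) i

    src≢snk : ∀ i j → src i ≢ snk j
    src≢snk i j eq = sourceLevel≢sinkLevel (kind i) (kind j)
      (Finₚ.combine-injectiveˡ _ i _ j (Finₚ.toℕ-injective eq))

    distinct : ∀ {e f} → [ src , snk ]′ e ≡ [ src , snk ]′ f → e ≡ f
    distinct {inj₁ i} {inj₁ j} eq = cong inj₁ (Finₚ.combine-injectiveʳ
      (sourceLevel (kind i)) i (sourceLevel (kind j)) j (Finₚ.toℕ-injective eq))
    distinct {inj₁ i} {inj₂ j} eq = contradiction eq (src≢snk i j)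
    distinct {inj₂ i} {inj₁ j} eq = contradiction (sym eq) (src≢snk j i)
    distinct {inj₂ i} {inj₂ j} eq = cong inj₂ (Finₚ.combine-injectiveʳ
      (sinkLevel (kind i)) i (sinkLevel (kind j)) j (Finₚ.toℕ-injective eq))

  diagram : ChordDiagram n
  diagram = relabel arrangement

  diagram-realises : Realises diagram kind
  diagram-realises = record
    { ordered = ordered
    ; source<sink⁺ = λ {i} {j} → crosses⁺ {i} {j}
    ; source<sink⁻ = λ {i} {j} → crosses⁻ {i} {j}
    ; rn⁺ = neighbour⁺
    ; rn⁻ = neighbour⁻ }
    where
    open ChordDiagram diagram using (source; sink)
    open Relabel arrangement using (label-mono)

    crosses⁺ : ∀ {i j} → sourceLevel (kind j) Fin.< sinkLevel (kind i) → source j Fin.< sink i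
    crosses⁺ {i} {j} lt = label-mono (inj₁ j) (inj₂ i) (Finₚ.combine-monoˡ-< j i lt)

    crosses⁻ : ∀ {i j} → source j Fin.< sink i → sourceLevel (kind j) Fin.< sinkLevel (kind i)
    crosses⁻ {i} {j} lt = ℕₚ.≤∧≢⇒<
      (position-cancel {i = j} {i} (label-reflects arrangement (inj₁ j) (inj₂ i) lt))
      (sourceLevel≢sinkLevel (kind j) (kind i) ∘ Finₚ.toℕ-injective)

    neighbour⁺ : ∀ {i j} → i Fin.< j → Meets (kind i) (kind j) → RightNeighbour diagram i j
    neighbour⁺ {i} {j} i<j (lt , le) =
      label-mono (inj₁ i) (inj₁ j) (Arrangement.source-mono arrangement i<j) ,
      crosses⁺ lt , label-mono (inj₂ i) (inj₂ j) (position-mono le i<j)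

    neighbour⁻ : ∀ {i j} → RightNeighbour diagram i j → kind i ⊑ kind j × Meets (kind i) (kind j)
    neighbour⁻ {i} {j} (i<j , j<si , si<sj) =
      ordered (source-cancel-< diagram i<j) , crosses⁻ j<si ,
      position-cancel {i = i} {j} (label-reflects arrangement (inj₂ i) (inj₂ j) si<sj)

-- Connectivity of the extremal diagrams and of their images.

pivot-isolated : ∀ k → pivot-class k ≡ true →
  ¬ (pivot ⊑ k × Meets pivot k) × ¬ (k ⊑ pivot × Meets k pivot)
pivot-isolated = from-yes (all? λ k → pivot-class k Bool.≟ true →-dec
  (¬? (pivot ⊑? k ×-dec meets? pivot k) ×-dec ¬? (k ⊑? pivot ×-dec meets? k pivot)))

-- In this class only early chords cross the pivot, and they lose it: a chord `e` after the pivot is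
-- final, and its source follows the early sinks.
ψ-pivot-isolated : ∀ k e → ψ-class k ≡ true → ¬ (pivot ⊑ k) ×
  ¬ ((k ⊑ pivot × Meets k pivot) × pivot ⊑ e × sourceLevel e Fin.< sinkLevel k)
ψ-pivot-isolated = from-yes (all? λ k → all? λ e → ψ-class k Bool.≟ true →-dec
  (¬? (pivot ⊑? k) ×-dec
   ¬? ((k ⊑? pivot ×-dec meets? k pivot) ×-dec pivot ⊑? e ×-dec sourceLevel e Finₚ.<? sinkLevel k)))

module _ {m : ℕ} (T : ChordDiagram (suc m)) (kind : Fin (suc m) → Kind) (realises : Realises T kind)
         (c : Fin (suc m)) (kind-c : kind c ≡ pivot) (kind-last : kind (fromℕ m) ≡ final) where
  open Realises realises

  not-final : ∀ {i} → i Fin.< fromℕ m → kind i ≢ final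
  not-final i<last eq = final-maximal _ (subst (_⊑ kind (fromℕ m)) eq (ordered i<last))

  <pivot⇒<c : ∀ {i} → BeforePivot (kind i) → i Fin.< c
  <pivot⇒<c {i} i<pivot = before kind ordered
    (λ { refl → <-irrefl (cong toℕ kind-c) i<pivot })
    (⊑-asym (kind i) (kind c) (subst (λ k → toℕ (kind i) < toℕ k) (sym kind-c) i<pivot))

  one-terminal : OneTerminal T
  one-terminal i i≢last terminal =
    [ (λ (i<pivot , M) → terminal c
        (rn⁺ (<pivot⇒<c i<pivot) (subst (Meets (kind i)) (sym kind-c) M)))
    , (λ M → terminal (fromℕ m) (rn⁺ i<last (subst (Meets (kind i)) (sym kind-last) M)))
    ]′ (meets-pivot-or-final (kind i) (not-final i<last))
    where
    i<last : i Fin.< fromℕ m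
    i<last = ℕₚ.≤∧≢⇒< (≤fromℕ i) λ eq → i≢last (cong suc (trans eq (Finₚ.toℕ-fromℕ m)))

  apart : ∀ {x y} → x ≢ y → ¬ Cross T x y → Apart Meets (kind x) (kind y)
  apart {x} {y} x≢y ¬a with Finₚ.<-cmp x y
  ... | tri< x<y _ _ = inj₁ (ordered x<y , λ M → ¬a (inj₁ (rn⁺ x<y M)))
  ... | tri≈ _ x≡y _ = contradiction x≡y x≢y
  ... | tri> _ _ y<x = inj₂ (ordered y<x , λ M → ¬a (inj₂ (rn⁺ y<x M)))

  κT : ∀ {μ} → IsConnectivity (intersectionGraph T) μ →
       ∣ class final-class kind ∣ ≤ ∣ class pivot-class kind ∣ →
       μ ≡ suc m ∸ ∣ class pivot-class kind ∣
  κT isConn size = κ-by-kind (intersectionGraph T) isConn kind Meets apart pivot-class final-class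
    pivot-class-closed final-class-closed apart⇒class size c (cong pivot-class kind-c)
    λ {v} v∈ → let l , r = pivot-isolated (kind v) v∈ in
      [ (λ rn → l (subst (λ k → k ⊑ kind v × Meets k (kind v)) kind-c (rn⁻ rn)))
      , (λ rn → r (subst (λ k → kind v ⊑ k × Meets (kind v) k) kind-c (rn⁻ rn))) ]′

  kind′ : Fin m → Kind
  kind′ = kind ∘ inject₁

  ψ-strong : ∀ {x y} → x Fin.< y → kind y ≢ final → ψ-Meets (kind x) (kind y) →
             StrongNeighbour T x y
  ψ-strong x<y y≢final (inj₁ y≡final) = contradiction y≡final y≢final
  ψ-strong {x} {y} x<y y≢final (inj₂ (M , p)) = rn⁺ x<y M , passes p
    where
    passes : (BeforePivot (kind y) × sourceLevel pivot Fin.< sinkLevel (kind x)) ⊎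
             sourceLevel final Fin.< sinkLevel (kind x) → Passes T x y
    passes (inj₁ (y<pivot , lt)) = c , <pivot⇒<c y<pivot ,
      source<sink⁺ {x} {c} (subst (λ k → sourceLevel k Fin.< sinkLevel (kind x)) (sym kind-c) lt)
    passes (inj₂ lt) = fromℕ m ,
      ℕₚ.≤∧≢⇒< (≤fromℕ y) (λ eq → y≢final (trans (cong kind (Finₚ.toℕ-injective eq)) kind-last)) ,
      source<sink⁺ {x} {fromℕ m}
        (subst (λ k → sourceLevel k Fin.< sinkLevel (kind x)) (sym kind-last) lt)

  module _ (H : Graph m)
           (ψ-cross⁺ : ∀ {x y} → StrongCross T (inject₁ x) (inject₁ y) → Graph.Adj H x y)
           (ψ-cross⁻ : ∀ {x y} → Graph.Adj H x y → StrongCross T (inject₁ x) (inject₁ y)) where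

    inject₁-mono : ∀ {x y : Fin m} → x Fin.< y → inject₁ x Fin.< inject₁ y
    inject₁-mono {x} {y} = subst₂ _<_ (sym (toℕ-inject₁ x)) (sym (toℕ-inject₁ y))

    kind′≢final : ∀ {x} → kind′ x ≢ final
    kind′≢final {x} = not-final
      (subst (toℕ (inject₁ x) <_) (sym (Finₚ.toℕ-fromℕ m)) (Finₚ.inject₁ℕ< x))

    ψ-apart : ∀ {x y} → x ≢ y → ¬ Graph.Adj H x y → Apart ψ-Meets (kind′ x) (kind′ y)
    ψ-apart {x} {y} x≢y ¬a with Finₚ.<-cmp x y
    ... | tri< x<y _ _ = inj₁ (ordered (inject₁-mono x<y) , λ M →
      ¬a (ψ-cross⁺ (inj₁ (ψ-strong (inject₁-mono x<y) kind′≢final M))))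
    ... | tri≈ _ x≡y _ = contradiction x≡y x≢y
    ... | tri> _ _ y<x = inj₂ (ordered (inject₁-mono y<x) , λ M →
      ¬a (ψ-cross⁺ (inj₂ (ψ-strong (inject₁-mono y<x) kind′≢final M))))

    pivot-not-strong : ∀ {i} → ψ-class (kind i) ≡ true → ¬ StrongCross T c i
    pivot-not-strong {i} i∈ (inj₁ (rn , _)) = proj₁ (ψ-pivot-isolated (kind i) pivot i∈)
      (subst (_⊑ kind i) kind-c (proj₁ (rn⁻ rn)))
    pivot-not-strong {i} i∈ (inj₂ (rn , e , c<e , e<si)) =
      proj₂ (ψ-pivot-isolated (kind i) (kind e) i∈)
        (subst (λ k → kind i ⊑ k × Meets (kind i) k) kind-c (rn⁻ rn) ,
         subst (_⊑ kind e) kind-c (ordered c<e) , source<sink⁻ {i} {e} e<si)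

    κψT : ∀ {ν} → IsConnectivity H ν → ν ≡ m ∸ ∣ class ψ-class kind ∣
    κψT conn with last-or-inject₁ T c (λ { refl → pivot≢final (trans (sym kind-c) kind-last) })
      where
      pivot≢final : _≢_ {A = Kind} pivot final
      pivot≢final ()
    ... | c′ , refl = trans
      (κ-by-kind H conn kind′ ψ-Meets ψ-apart ψ-class ψ-class ψ-class-closed ψ-class-closed
        (λ k l a → inj₁ (apart⇒ψ-class k l a)) ≤-refl c′ (cong ψ-class kind-c)
        (λ v∈ a → pivot-not-strong v∈ (ψ-cross⁻ a)))
      -- The final chord lies outside `ψ-class`, so deleting it keeps the size of the class.
      (cong (m ∸_) (trans
        (cong ∣_∣ (tabulate-cong λ x → sym (lookup∘tabulate (ψ-class ∘ kind) (inject₁ x))))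
        (sym (∣restrict∣-∉ (class ψ-class kind) λ l∈ →
          false≢true (trans (cong ψ-class (sym kind-last)) (∈-class⁻ ψ-class kind l∈))))))
      where
      false≢true : false ≢ true
      false≢true ()

-- Sequences of kinds with prescribed multiplicities.

Ordered : ∀ {n} → Vec Kind n → Set
Ordered v = ∀ {i j} → i Fin.< j → lookup v i ⊑ lookup v j

lookup-replicate-++ : ∀ {n} {Q : Kind → Set} p {k} {v : Vec Kind n} → Q k → (∀ i → Q (lookup v i)) →
                      ∀ i → Q (lookup (replicate p k ++ v) i)
lookup-replicate-++ zero qk qv i = qv i
lookup-replicate-++ (suc p) qk qv zero = qk
lookup-replicate-++ {Q = Q} (suc p) qk qv (suc i) = lookup-replicate-++ {Q = Q} p qk qv i

∷-ordered : ∀ {n k} {v : Vec Kind n} → (∀ i → k ⊑ lookup v i) → Ordered v → Ordered (k ∷ v)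
∷-ordered k⊑v ord {zero} {suc j} _ = k⊑v j
∷-ordered k⊑v ord {suc i} {suc j} (s≤s i<j) = ord i<j

replicate-++-ordered : ∀ {n} p {k} {v : Vec Kind n} → k ⊑ k → (∀ i → k ⊑ lookup v i) → Ordered v →
                       Ordered (replicate p k ++ v)
replicate-++-ordered zero k⊑k k⊑v ord = ord
replicate-++-ordered (suc p) {k} k⊑k k⊑v ord =
  ∷-ordered (lookup-replicate-++ {Q = k ⊑_} p k⊑k k⊑v) (replicate-++-ordered p k⊑k k⊑v ord)

∣map-replicate-++∣ : ∀ {n} (f : Kind → Bool) p k (v : Vec Kind n) →
  ∣ map f (replicate p k ++ v) ∣ ≡ (if f k then p else 0) + ∣ map f v ∣
∣map-replicate-++∣ f zero k v with f k
... | true = refl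
... | false = refl
∣map-replicate-++∣ f (suc p) k v with f k | ∣map-replicate-++∣ f p k v
... | true | eq = cong suc eq
... | false | eq = eq

-- Indexed by `n` so that it can be transported from the sum of the multiplicities to the form
-- `suc m`.
record Layout (n p s q : ℕ) : Set where
  field
    kind        : Fin n → Kind
    ordered     : ∀ {i j} → i Fin.< j → kind i ⊑ kind j
    c l         : Fin n
    kind-c      : kind c ≡ pivot
    kind-l      : kind l ≡ final
    class-size  : ∀ f → ∣ class f kind ∣ ≡ (if f early then p else 0) +
      ((if f spanning then s else 0) + ((if f long then q else 0) + ∣ f pivot ∷ f final ∷ [] ∣))

layout : ∀ p s q → Layout (p + (s + (q + 2))) p s q
layout p s q = record
  { kind = lookup v
  ; ordered = replicate-++-ordered p (inj₂ (refl , s≤s z≤n)) (early⊑ ∘ lookup v₁)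
      (replicate-++-ordered s (inj₂ (refl , s≤s (s≤s z≤n)))
        (lookup-replicate-++ {Q = spanning ⊑_} q (inj₁ ≤-refl)
          (from-yes (all? λ i → spanning ⊑? lookup v₃ i)))
        (replicate-++-ordered q (inj₂ (refl , ≤-refl))
          (from-yes (all? λ i → long ⊑? lookup v₃ i))
          (∷-ordered {v = final ∷ []} (λ { zero → inj₁ ≤-refl }) λ { {zero} {zero} () })))
  ; c = p ↑ʳ (s ↑ʳ (q ↑ʳ zero))
  ; l = p ↑ʳ (s ↑ʳ (q ↑ʳ suc zero))
  ; kind-c = at zero
  ; kind-l = at (suc zero)
  ; class-size = λ f → trans
      (cong ∣_∣ (trans (tabulate-∘ f (lookup v)) (cong (map f) (tabulate∘lookup v))))
      (trans (∣map-replicate-++∣ f p early v₁) (cong (_ +_)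
      (trans (∣map-replicate-++∣ f s spanning v₂) (cong (_ +_)
      (∣map-replicate-++∣ f q long v₃)))))
  }
  where
  v₃ : Vec Kind 2
  v₃ = pivot ∷ final ∷ []
  v₂ = replicate q long ++ v₃
  v₁ = replicate s spanning ++ v₂
  v = replicate p early ++ v₁

  early⊑ : ∀ k → early ⊑ k
  early⊑ = from-yes (all? λ k → early ⊑? k)

  at : ∀ i → lookup v (p ↑ʳ (s ↑ʳ (q ↑ʳ i))) ≡ lookup v₃ i
  at i = trans (lookup-++ʳ (replicate p early) v₁ _) (trans (lookup-++ʳ (replicate s spanning) v₂ _)
    (lookup-++ʳ (replicate q long) v₃ i))

-- The bounds and their attainment.

module _ {m : ℕ} (T : ChordDiagram (suc m)) where

  ψ-cross⁺ : ∀ {c d} → StrongCross T (inject₁ c) (inject₁ d) → Cross (ψ T) c d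
  ψ-cross⁺ = Sum.map (ψ-rn⁺ T) (ψ-rn⁺ T)

  ψ-cross⁻ : ∀ {c d} → Cross (ψ T) c d → StrongCross T (inject₁ c) (inject₁ d)
  ψ-cross⁻ = Sum.map (ψ-rn⁻ T) (ψ-rn⁻ T)

κ-isConnectivity : ∀ {n} (C : ChordDiagram n) → IsConnectivity (intersectionGraph C) (κ C)
κ-isConnectivity C = proj₂ (connectivity (intersectionGraph C))

κψ-bounds : ∀ m k → 1 ≤ k → k < suc m →
  (T : ChordDiagram (suc m)) → OneTerminal T → κ T ≡ suc m ∸ k →
  suc m ≤ κ (ψ T) + 2 * k × κ (ψ T) < suc m ∸ k
κψ-bounds m k 1≤k k<n T one-terminal κ≡ =
  n≤ν+2k T one-terminal (intersectionGraph (ψ T)) (ψ-cross⁺ T) (ψ-cross⁻ T)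
    (κ-isConnectivity T) (κ-isConnectivity (ψ T)) 1≤k k<n κ≡ ,
  ≤-trans (ν<μ T one-terminal (intersectionGraph (ψ T)) (ψ-cross⁺ T) (ψ-cross⁻ T)
    (κ-isConnectivity T) (κ-isConnectivity (ψ T)) (≤-trans 1≤k (s≤s⁻¹ k<n))) (≤-reflexive κ≡)

layout-diagram : ∀ {m p s q} → Layout (suc m) p s q → p ≤ q →
  ∃[ T ] (OneTerminal {suc m} T × κ T ≡ suc m ∸ suc q × κ (ψ T) ≡ m ∸ (p + suc q))
layout-diagram {m} {p} {s} {q} L p≤q = T ,
  one-terminal T kind realises c kind-c kind-last ,
  trans (κT T kind realises c kind-c kind-last (κ-isConnectivity T)
    -- The two classes have `p + 1` and `q + 1` chords.
    (subst₂ _≤_ (sym (class-size final-class)) (sym (class-size pivot-class)) (ℕₚ.+-monoˡ-≤ 1 p≤q)))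
    (cong (suc m ∸_) (trans (class-size pivot-class) (ℕₚ.+-comm q 1))) ,
  trans (κψT T kind realises c kind-c kind-last (intersectionGraph (ψ T))
    (ψ-cross⁺ T) (ψ-cross⁻ T) (κ-isConnectivity (ψ T)))
    (cong (m ∸_) (trans (class-size ψ-class) (cong (p +_) (ℕₚ.+-comm q 1))))
  where
  open Layout L
  T : ChordDiagram (suc m)
  T = diagram kind ordered

  realises : Realises T kind
  realises = diagram-realises kind ordered

  kind-last : kind (fromℕ m) ≡ final
  -- No chord follows one of final kind, so `l` is the last index.
  kind-last = subst (λ i → kind i ≡ final) (Finₚ.toℕ-injective (ℕₚ.≤-antisym (≤fromℕ l)
    (ℕₚ.≮⇒≥ λ l<last → final-maximal _ (subst (_⊑ kind (fromℕ m)) kind-l (ordered l<last))))) kind-l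

κψ-attained : ∀ m k j → 1 ≤ k → k < suc m → suc m ≤ j + 2 * k → j < suc m ∸ k →
  ∃[ T ] (OneTerminal {suc m} T × κ T ≡ suc m ∸ k × κ (ψ T) ≡ j)
κψ-attained m (suc q) j _ k<n n≤j+2k j<n∸k =
  let T , one-terminal , κT≡ , κψT≡ =
        layout-diagram (subst (λ n → Layout n p j q) size (layout p j q)) p≤q
  in T , one-terminal , κT≡ , trans κψT≡ m∸≡j
  where
  -- With `j` spanning and `q` long chords, this many early ones give size `suc m`: `j < n ∸ k`
  -- makes the subtraction exact, and `n ≤ j + 2 * k` becomes `p ≤ q`.
  p : ℕ
  p = m ∸ (j + suc q)

  j+k≤m : j + suc q ≤ m
  j+k≤m = s≤s⁻¹ (ℕₚ.m≤o∸n⇒m+n≤o (suc j) (ℕₚ.<⇒≤ k<n) j<n∸k)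

  p≤q : p ≤ q
  p≤q = ℕₚ.m≤n+o⇒m∸n≤o m (j + suc q) (s≤s⁻¹ (≤-trans n≤j+2k (≤-reflexive
    (solve 2 (λ j q → j :+ (con 2 :* (con 1 :+ q)) := con 1 :+ (j :+ (con 1 :+ q) :+ q)) refl j q))))
    where open +-*-Solver

  m≡ : p + (j + suc q) ≡ m
  m≡ = ℕₚ.m∸n+n≡m j+k≤m

  size : p + (j + (q + 2)) ≡ suc m
  size = trans
    (solve 3 (λ p j q → p :+ (j :+ (q :+ con 2)) := con 1 :+ (p :+ (j :+ (con 1 :+ q)))) refl p j q)
    (cong suc m≡)
    where open +-*-Solver

  m∸≡j : m ∸ (p + suc q) ≡ j
  m∸≡j = trans (cong (_∸ (p + suc q)) (trans (sym m≡)
      (solve 3 (λ p j q → p :+ (j :+ (con 1 :+ q)) := j :+ (p :+ (con 1 :+ q))) refl p j q)))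
    (ℕₚ.m+n∸n≡m j (p + suc q))
    where open +-*-Solver

theorem8p19 : (∀ m k → let n = suc m in 1 ≤ k → k < n →
    (T : ChordDiagram n) → OneTerminal T → κ T ≡ n ∸ k →
    n ≤ κ (ψ T) + 2 * k × κ (ψ T) < n ∸ k)
    ×
    (∀ m k j → let n = suc m in 1 ≤ k → k < n → n ≤ j + 2 * k → j < n ∸ k →
    ∃[ T ] (OneTerminal {n} T × κ T ≡ n ∸ k × κ (ψ T) ≡ j))
theorem8p19 = κψ-bounds , κψ-attained
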